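{- Let $D$ denote the kite. For every $v\equiv 0,1\pmod 8$ with $v>1$, \[\mathcal{L}_1D(v)=\{n\geq v-1\mid n\equiv 0,1\pmod 4\},\] \[\mathcal{L}_2D(v)=\{n\geq v\mid n\equiv 0,1\pmod 4\}.\]
   Context: All graphs are finite and simple; $\Gamma\leq K$ means $\Gamma$ is a subgraph of $K$ (or is isomorphic to one, when $\Gamma$ is an abstract graph). $P_3$ is the path on $3$ vertices. The kite $D$ is a triangle with an attached edge: the graph with vertices $a,b,c,d$ and edges $ca,cb,cd,ab$. For a graph $K$ and $\Gamma\leq K$, a $(K,\Gamma)$-design is a set $\mathcal{B}$ of subgraphs of $K$, called blocks, each isomorphic to $\Gamma$, whose edge-sets partition $E(K)$. $K_n$ is the complete graph on a set of $n$ vertices (any $n$-element vertex set may be used); a $\Gamma$-design of order $n$ is a $(K_n,\Gamma)$-design. Given $\Gamma'\leq\Gamma$, a $(K,\Gamma)$-design $\mathcal{B}$ and a $(K',\Gamma')$-design $\mathcal{B}'$, a down-link from $\mathcal{B}$ to $\mathcal{B}'$ is a function $f:\mathcal{B}\to\mathcal{B}'$ such that $f(B)$ is a subgraph of $B$ for every $B\in\mathcal{B}$ (the vertex sets of $K$ and $K'$ need not coincide, and either may be the larger). Take $\Gamma'=P_3$. For $v$ such that a $(K_v,\Gamma)$-design exists: $\mathcal{L}_1\Gamma(v)$ is the set of all integers $n$ such that some $\Gamma$-design of order $v$ can be down-linked to a $P_3$-design of order $n$; $\mathcal{L}_2\Gamma(v)$ is the set of all integers $n$ such that every $\Gamma$-design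 of order $v$ can be down-linked to a $P_3$-design of order $n$. A $(K_v,D)$-design exists if and only if $v\equiv 0,1\pmod 8$, $v>1$. -}

module Defs where

open import Data.Fin.Base using (Fin)
open import Data.List.Base using (List; []; _∷_; length)
open import Data.List.Membership.Propositional using (_∈_)
open import Data.List.Relation.Binary.Subset.Propositional using (_⊆_)
open import Data.List.Relation.Unary.All as All using (All)
open import Data.List.Relation.Unary.Unique.Propositional using (Unique)
open import Data.List.Relation.Unary.Unique.DecPropositional using (unique?)
open import Data.Nat.Base using (ℕ)
open import Data.Nat.Properties using (_≟_)
open import Data.Product using (_×_; _,_; proj₁; Σ-syntax; ∃!)
open import Data.Product.Properties using (≡-dec)
open import Data.Sum.Base using (_⊎_; inj₁; inj₂; swap)
open import Function.Bundles using (_⇔_)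
open import Function.Definitions using (Injective)
open import Level using (0ℓ; suc)
open import Relation.Binary.Core using (Rel)
open import Relation.Binary.Definitions using (Decidable; Symmetric)
open import Relation.Binary.PropositionalEquality using (_≡_; _≢_; refl; sym)
open import Relation.Nullary using (¬_; Dec; from-yes; ¬?; _×-dec_; _⊎-dec_)
open import Relation.Unary using (Pred)

import Data.List.Membership.DecPropositional as DecMembership
open DecMembership _≟_ using (_∈?_)
open DecMembership (≡-dec _≟_ _≟_) using () renaming (_∈?_ to _∈ₑ?_)

-- Vertices of all graphs are drawn from the one infinite set ℕ, so that graphs
-- with different, possibly overlapping, vertex sets can be compared by the
-- subgraph relation.
record Graph : Set (suc 0ℓ) where
  field
    V        : List ℕ
    unique   : Unique V
    Adj      : Rel ℕ 0ℓ
    adj?     : Decidable Adj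
    adj-sym  : Symmetric Adj
    loopless : ∀ {x} → ¬ Adj x x
    adj⇒∈    : ∀ {x y} → Adj x y → x ∈ V

open Graph

infix 4 _⊑_ _≈_ _≅_ _≲_

record _⊑_ (H G : Graph) : Set where
  field
    V-⊆   : V H ⊆ V G
    Adj-⊆ : ∀ {x y} → Adj H x y → Adj G x y

-- Equality of graphs as pairs (vertex set, edge set).
_≈_ : Rel Graph 0ℓ
G ≈ H = G ⊑ H × H ⊑ G

-- The values of `to` and `from` outside the vertex sets are irrelevant.
record _≅_ (G H : Graph) : Set where
  field
    to      : ℕ → ℕ
    from    : ℕ → ℕ
    to-∈    : ∀ {x} → x ∈ V G → to x ∈ V H
    from-∈  : ∀ {y} → y ∈ V H → from y ∈ V G
    from-to : ∀ {x} → x ∈ V G → from (to x) ≡ x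
    to-from : ∀ {y} → y ∈ V H → to (from y) ≡ y
    to-adj  : ∀ {x y} → x ∈ V G → y ∈ V G → Adj G x y ⇔ Adj H (to x) (to y)

_≲_ : Graph → Graph → Set (suc 0ℓ)
Γ ≲ K = Σ[ H ∈ Graph ] H ⊑ K × H ≅ Γ

complete : (X : List ℕ) → Unique X → Graph
complete X X! = record
  { V        = X
  ; unique   = X!
  ; Adj      = λ x y → x ∈ X × y ∈ X × x ≢ y
  ; adj?     = λ x y → (x ∈? X) ×-dec (y ∈? X) ×-dec ¬? (x ≟ y)
  ; adj-sym  = λ (x∈ , y∈ , x≢y) → y∈ , x∈ , λ y≡x → x≢y (sym y≡x)
  ; loopless = λ (_ , _ , x≢x) → x≢x refl
  ; adj⇒∈    = proj₁
  }

ValidEdge : List ℕ → ℕ × ℕ → Set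
ValidEdge X (x , y) = x ∈ X × y ∈ X × x ≢ y

-- Each unordered edge is listed once, in either orientation.
fromEdges : (X : List ℕ) → Unique X →
            (E : List (ℕ × ℕ)) → All (ValidEdge X) E → Graph
fromEdges X X! E valid = record
  { V        = X
  ; unique   = X!
  ; Adj      = λ x y → (x , y) ∈ E ⊎ (y , x) ∈ E
  ; adj?     = λ x y → ((x , y) ∈ₑ? E) ⊎-dec ((y , x) ∈ₑ? E)
  ; adj-sym  = swap
  ; loopless = λ { (inj₁ e) → irrefl e ; (inj₂ e) → irrefl e }
  ; adj⇒∈    = λ { (inj₁ e) → let (x∈ , _ , _) = All.lookup valid e in x∈
                 ; (inj₂ e) → let (_ , x∈ , _) = All.lookup valid e in x∈ }
  }
  where
  irrefl : ∀ {x} → ¬ (x , x) ∈ E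
  irrefl e = let (_ , _ , x≢x) = All.lookup valid e in x≢x refl

validEdges? : ∀ X E → Dec (All (ValidEdge X) E)
validEdges? X = All.all? λ (x , y) → (x ∈? X) ×-dec (y ∈? X) ×-dec ¬? (x ≟ y)

P₃ : Graph
P₃ = fromEdges X (from-yes (unique? _≟_ X)) E (from-yes (validEdges? X E))
  where
  X = 0 ∷ 1 ∷ 2 ∷ []
  E = (0 , 1) ∷ (1 , 2) ∷ []

kite : Graph
kite = fromEdges X (from-yes (unique? _≟_ X)) E (from-yes (validEdges? X E))
  where
  a = 0
  b = 1
  c = 2
  d = 3
  X = a ∷ b ∷ c ∷ d ∷ []
  E = (c , a) ∷ (c , b) ∷ (c , d) ∷ (a , b) ∷ []

-- The set of blocks is given by an injective enumeration.
record Design (K Γ : Graph) : Set (suc 0ℓ) where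
  field
    Γ≲K       : Γ ≲ K
    size      : ℕ
    block     : Fin size → Graph
    distinct  : Injective _≡_ _≈_ block
    subgraph  : ∀ i → block i ⊑ K
    copy      : ∀ i → block i ≅ Γ
    partition : ∀ {x y} → Adj K x y → ∃! _≡_ λ i → Adj (block i) x y

record DesignOfOrder (Γ : Graph) (n : ℕ) : Set (suc 0ℓ) where
  field
    points  : List ℕ
    points! : Unique points
    order   : length points ≡ n
    design  : Design (complete points points!) Γ

record DownLink {K Γ K′ Γ′ : Graph}
                (𝓑 : Design K Γ) (𝓑′ : Design K′ Γ′) : Set where
  private
    module B  = Design 𝓑
    module B′ = Design 𝓑′
  field
    f   : Fin B.size → Fin B′.size
    f-⊑ : ∀ i → B′.block (f i) ⊑ B.block i

DownLinkable : ∀ {Γ v} → DesignOfOrder Γ v → Pred ℕ (suc 0ℓ)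
DownLinkable 𝓑 n = Σ[ 𝓑′ ∈ DesignOfOrder P₃ n ]
  DownLink (DesignOfOrder.design 𝓑) (DesignOfOrder.design 𝓑′)

𝓛₁ : Graph → ℕ → Pred ℕ (suc 0ℓ)
𝓛₁ Γ v n = Σ[ 𝓑 ∈ DesignOfOrder Γ v ] DownLinkable 𝓑 n

𝓛₂ : Graph → ℕ → Pred ℕ (suc 0ℓ)
𝓛₂ Γ v n = (𝓑 : DesignOfOrder Γ v) → DownLinkable 𝓑 n

{-# OPTIONS --safe #-}
-- Encoding an unordered edge as a sorted pair, a design is a list of labellings of the pattern whose
-- edges are a permutation of the edges of the complete graph.
--
-- Two points of the kite design outside the P₃-design would lie in a common block, leaving only two
-- vertices for its path; hence n ≥ v - 1.  Conversely a kite splits into two paths, and for n > v any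
-- of the new points is joined to all other points by unused edges.  A graph with an even number of
-- edges and a spanning tree decomposes into paths, by pairing edges at the leaves first.
--
-- The order n = v - 1 requires a point that is nowhere the centre of a kite.  For v = 8k + 1 the
-- starters (2i+1, 3k-i, 3k+i+1; 2i+2), i < k, develop to a cyclic design in which every point is a
-- centre, and exchanging pendant edges between pairs of kites yields one in which 0 never is.
-- For v = 8k similar starters modulo v - 1 give a design with one fixed point, and v - 1 is not
-- congruent to 0 or 1 modulo 4.
module Submission where

open import Defs

open import Data.Fin.Base using (Fin; zero; suc)
open import Data.List.Base
  using (List; []; _∷_; [_]; _++_; map; concat; concatMap; fromMaybe; length; lookup; tabulate; upTo; applyDownFrom)
open import Data.List.Membership.Propositional using (_∈_; _∉_; find; lose)
open import Data.List.Membership.Propositional.Properties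
open import Data.List.Properties
  using (length-++; length-map; length-upTo; length-applyDownFrom; ++-assoc; ++-identityʳ;
         map-id-local; map-∘; map-tabulate; concatMap-map; concatMap-++)
open import Data.List.Relation.Binary.Disjoint.Propositional using (Disjoint)
open import Data.List.Relation.Binary.Permutation.Propositional
  using (_↭_; prep; ↭-refl; ↭-sym; ↭-trans; ↭-reflexive; ↭⇒↭ₛ; module PermutationReasoning)
open import Data.List.Relation.Binary.Permutation.Propositional.Properties as ↭
  using (↭-length; ∈-resp-↭)
import Data.List.Relation.Binary.Permutation.Setoid.Properties as ↭ₛ
open import Data.List.Relation.Binary.Subset.Propositional using (_⊆_)
open import Data.List.Relation.Unary.All as All using (All; []; _∷_)
import Data.List.Relation.Unary.All.Properties as All
open import Data.List.Relation.Unary.AllPairs using ([]; _∷_)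
import Data.List.Relation.Unary.AllPairs.Properties as AllPairs
open import Data.List.Relation.Unary.Any as Any using (here; there)
open import Data.List.Relation.Unary.Any.Properties using (lookup-index)
open import Data.List.Relation.Unary.Unique.DecPropositional using (unique?)
open import Data.List.Relation.Unary.Unique.Propositional using (Unique)
import Data.List.Relation.Unary.Unique.Propositional.Properties as Unique
open import Data.Bool.Base using (if_then_else_)
open import Data.Maybe.Base using (just; nothing)
open import Data.Nat.Base
  using (ℕ; zero; suc; _+_; _*_; _∸_; _<_; _≤_; _≥_; _>_; _⊓_; _⊔_; s≤s; z≤n; s<s)
open import Data.Nat.DivMod
  using (_%_; _/_; %-distribˡ-+; m%n%n≡m%n; [m+n]%n≡m%n; [m+kn]%n≡m%n; m<n⇒m%n≡m; m%n<n; m≡m%n+[m/n]*n)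
open import Data.Nat.Divisibility
  using (_∣_; divides; ∣m+n∣m⇒∣n; ∣1⇒≡1; n∣m⇒m%n≡0; n∣m*n; ∣m∣n⇒∣m+n)
open import Data.Nat.Properties
open import Data.Nat.Tactic.RingSolver using (solve-∀)
open import Data.Product as Product using (∃; ∃₂; _×_; _,_; proj₁; proj₂; uncurry)
open import Data.Product.Properties using (≡-dec)
open import Data.Sum.Base using (_⊎_; inj₁; inj₂; [_,_]′)
open import Function.Base using (_∘_; _$_)
open import Function.Bundles using (_⇔_; mk⇔; Equivalence)
open import Relation.Binary.Definitions using (Tri; tri<; tri≈; tri>)
open import Relation.Binary.PropositionalEquality hiding ([_])
open import Relation.Nullary using (¬_; ¬?; does; yes; no; contradiction; from-yes)
open import Relation.Nullary.Decidable using (decidable-stable; dec-true; dec-false)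
open import Relation.Unary using (_≐_)
import Algebra.Solver.CommutativeMonoid as CommutativeMonoidSolver
import Data.List.Membership.DecPropositional as DecMembership

open DecMembership _≟_ using (_∈?_)
open CommutativeMonoidSolver (↭.++-commutativeMonoid {A = ℕ × ℕ}) using (solve; _⊕_; _⊜_)
open Graph

private variable
  A B : Set
  x y z u v w n : ℕ
  X Y vs : List ℕ

-- Finite lists

unique-↭ : {xs ys : List A} → xs ↭ ys → Unique xs → Unique ys
unique-↭ = ↭ₛ.Unique-resp-↭ (setoid _) ∘ ↭⇒↭ₛ

∈⇒↭ : {x : A} {xs : List A} → x ∈ xs → ∃ λ ys → xs ↭ x ∷ ys
∈⇒↭ x∈xs with ys , zs , refl ← ∈-∃++ x∈xs = ys ++ zs , ↭.shift _ ys zs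

unique-⊆⇒↭ : {xs ys : List A} → Unique xs → xs ⊆ ys → ∃ λ zs → ys ↭ xs ++ zs
unique-⊆⇒↭ {xs = []} _ _ = _ , ↭-refl
unique-⊆⇒↭ {xs = x ∷ xs} x∷xs!@(_ ∷ xs!) x∷xs⊆ys
  with ys′ , ys↭ ← ∈⇒↭ (x∷xs⊆ys (here refl))
  with zs , ys′↭ ← unique-⊆⇒↭ {ys = ys′} xs!
         (λ w∈xs → Any.tail (λ { refl → Unique.Unique[x∷xs]⇒x∉xs x∷xs! w∈xs })
                            (∈-resp-↭ ys↭ (x∷xs⊆ys (there w∈xs))))
  = zs , ↭-trans ys↭ (prep x ys′↭)

unique-⊆⇒≤ : {xs ys : List A} → Unique xs → xs ⊆ ys → length xs ≤ length ys
unique-⊆⇒≤ {xs = xs} xs! xs⊆ys with zs , ys↭ ← unique-⊆⇒↭ xs! xs⊆ys =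
  subst (length xs ≤_) (sym (trans (↭-length ys↭) (length-++ xs))) (m≤m+n _ _)

-- Counting replaces a check of disjointness: a list of this length that contains the distinct
-- entries of `xs` has no room for a repetition. For the cyclic designs it remains to show only that
-- every edge is covered.
covering⇒↭ : {xs ys : List A} → Unique xs → xs ⊆ ys → length ys ≡ length xs → ys ↭ xs
covering⇒↭ {xs = xs} xs! xs⊆ys len with unique-⊆⇒↭ xs! xs⊆ys
... | [] , ys↭ = ↭-trans ys↭ (↭-reflexive (++-identityʳ xs))
... | z ∷ zs , ys↭ = contradiction
  (trans (sym (trans (↭-length ys↭) (length-++ xs))) (trans len (sym (+-identityʳ _))))
  (λ eq → 1+n≢0 (+-cancelˡ-≡ (length xs) _ _ eq))

mutual-⊆⇒↭ : {xs ys : List A} → Unique xs → Unique ys → xs ⊆ ys → ys ⊆ xs → ys ↭ xs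
mutual-⊆⇒↭ xs! ys! xs⊆ys ys⊆xs =
  covering⇒↭ xs! xs⊆ys (≤-antisym (unique-⊆⇒≤ ys! ys⊆xs) (unique-⊆⇒≤ xs! xs⊆ys))

pigeonhole : Unique X → length Y < length X → ∃ λ x → x ∈ X × x ∉ Y
pigeonhole {X} {Y} X! Y<X with Any.any? (λ x → ¬? (x ∈? Y)) X
... | yes any = find any
... | no none = contradiction
  (unique-⊆⇒≤ X! λ {x} x∈X → decidable-stable (x ∈? Y) (none ∘ lose x∈X))
  (<⇒≱ Y<X)

fresh : ∀ X → Unique X → ∀ m → ∃ λ N → length N ≡ m × Unique (N ++ X)
fresh X X! zero = [] , refl , X!
fresh X X! (suc m)
  with N , len , N++X! ← fresh X X! m
  with x , _ , x∉ ← pigeonhole {Y = N ++ X} (Unique.upTo⁺ (suc (length (N ++ X))))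
                      (≤-reflexive (sym (length-upTo (suc (length (N ++ X))))))
  = x ∷ N , cong suc len , All.¬Any⇒All¬ _ x∉ ∷ N++X!

++-unique⇒disjoint : (xs : List A) {ys : List A} → Unique (xs ++ ys) → Disjoint xs ys
++-unique⇒disjoint (x ∷ xs) u@(_ ∷ _)  (here refl , x∈ys) =
  Unique.Unique[x∷xs]⇒x∉xs u (∈-++⁺ʳ xs x∈ys)
++-unique⇒disjoint (x ∷ xs) (_ ∷ u) (there e∈xs , e∈ys) = ++-unique⇒disjoint xs u (e∈xs , e∈ys)

++-uniqueʳ : (xs : List A) {ys : List A} → Unique (xs ++ ys) → Unique ys
++-uniqueʳ []       u       = u
++-uniqueʳ (_ ∷ xs) (_ ∷ u) = ++-uniqueʳ xs u

++-uniqueˡ : (xs : List A) {ys : List A} → Unique (xs ++ ys) → Unique xs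
++-uniqueˡ []       _       = []
++-uniqueˡ (_ ∷ xs) (p ∷ u) = All.++⁻ˡ xs p ∷ ++-uniqueˡ xs u

concatMap-unique : (f : A → List B) {x : A} {xs : List A} →
                   Unique (concatMap f xs) → x ∈ xs → Unique (f x)
concatMap-unique f {xs = x ∷ _} u (here refl) = ++-uniqueˡ (f x) u
concatMap-unique f {xs = x ∷ _} u (there x∈)  = concatMap-unique f (++-uniqueʳ (f x) u) x∈

concatMap-∈ : (f : A → List B) {x : A} {xs : List A} {e : B} →
              x ∈ xs → e ∈ f x → e ∈ concatMap f xs
concatMap-∈ f x∈xs e∈ = ∈-concatMap⁺ f (lose x∈xs e∈)

-- Turns a list of edges without repetitions into the uniqueness half of a partition: no edge lies
-- in blocks at two positions.
concatMap-index-unique : (f : A → List B) (xs : List A) {e : B} →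
  Unique (concatMap f xs) → (i j : Fin (length xs)) →
  e ∈ f (lookup xs i) → e ∈ f (lookup xs j) → i ≡ j
concatMap-index-unique f (x ∷ xs) u zero    zero    _ _ = refl
concatMap-index-unique f (x ∷ xs) u zero    (suc j) p q =
  contradiction (p , concatMap-∈ f (∈-lookup {xs = xs} j) q) (++-unique⇒disjoint (f x) u)
concatMap-index-unique f (x ∷ xs) u (suc i) zero    p q =
  contradiction (q , concatMap-∈ f (∈-lookup {xs = xs} i) p) (++-unique⇒disjoint (f x) u)
concatMap-index-unique f (x ∷ xs) u (suc i) (suc j) p q =
  cong suc (concatMap-index-unique f xs (++-uniqueʳ (f x) u) i j p q)

concatMap-split : (f g h : A → List B) (xs : List A) →
  (∀ {x} → x ∈ xs → f x ↭ g x ++ h x) →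
  concatMap f xs ↭ concatMap g xs ++ concatMap h xs
concatMap-split f g h []       _ = ↭-refl
concatMap-split f g h (x ∷ xs) p = begin
  f x ++ concatMap f xs                                 ↭⟨ ↭.++⁺ (p (here refl)) (concatMap-split f g h xs (p ∘ there)) ⟩
  (g x ++ h x) ++ concatMap g xs ++ concatMap h xs      ↭⟨ ↭.++-assoc (g x) (h x) _ ⟩
  g x ++ h x ++ concatMap g xs ++ concatMap h xs        ↭⟨ ↭.++⁺ˡ (g x) (↭.shifts (h x) (concatMap g xs)) ⟩
  g x ++ concatMap g xs ++ h x ++ concatMap h xs        ↭⟨ ↭.++-assoc (g x) _ _ ⟨
  (g x ++ concatMap g xs) ++ h x ++ concatMap h xs      ∎
  where open PermutationReasoning

length-concatMap : (f : A → List B) (n : ℕ) (xs : List A) →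
  (∀ x → length (f x) ≡ n) → length (concatMap f xs) ≡ length xs * n
length-concatMap f n []       _ = refl
length-concatMap f n (x ∷ xs) p =
  trans (length-++ (f x)) (cong₂ _+_ (p x) (length-concatMap f n xs p))

-- Edges of complete graphs.

-- An unordered edge is represented by its sorted pair of endpoints.
Edge : Set
Edge = ℕ × ℕ

infix 6 _─_
_─_ : ℕ → ℕ → Edge
x ─ y = x ⊓ y , x ⊔ y

─-comm : ∀ x y → x ─ y ≡ y ─ x
─-comm x y = cong₂ _,_ (⊓-comm x y) (⊔-comm x y)

─-sorted : x ≤ y → x ─ y ≡ (x , y)
─-sorted x≤y = cong₂ _,_ (m≤n⇒m⊓n≡m x≤y) (m≤n⇒m⊔n≡n x≤y)

endpoints : ∀ x y → ((x , y) ≡ x ─ y) ⊎ ((y , x) ≡ x ─ y)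
endpoints x y with ≤-total x y
... | inj₁ x≤y = inj₁ (sym (─-sorted x≤y))
... | inj₂ y≤x = inj₂ (sym (trans (─-comm x y) (─-sorted y≤x)))

─-injective : x ─ y ≡ u ─ w → (x ≡ u × y ≡ w) ⊎ (x ≡ w × y ≡ u)
─-injective {x} {y} {u} {w} eq with endpoints x y | endpoints u w
... | inj₁ p | inj₁ q with refl ← trans p (trans eq (sym q)) = inj₁ (refl , refl)
... | inj₁ p | inj₂ q with refl ← trans p (trans eq (sym q)) = inj₂ (refl , refl)
... | inj₂ p | inj₁ q with refl ← trans p (trans eq (sym q)) = inj₂ (refl , refl)
... | inj₂ p | inj₂ q with refl ← trans p (trans eq (sym q)) = inj₁ (refl , refl)

─-cancelˡ : x ─ y ≡ x ─ w → y ≡ w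
─-cancelˡ eq with ─-injective eq
... | inj₁ (_ , y≡w)    = y≡w
... | inj₂ (refl , y≡x) = y≡x

edges : List ℕ → List Edge
edges []       = []
edges (x ∷ xs) = map (x ─_) xs ++ edges xs

∈-edges⁺ : x ∈ X → y ∈ X → x ≢ y → x ─ y ∈ edges X
∈-edges⁺ (here refl) (here refl) x≢y = contradiction refl x≢y
∈-edges⁺ {X = _ ∷ X} (here refl) (there y∈) _ = ∈-++⁺ˡ (∈-map⁺ _ y∈)
∈-edges⁺ {x} {X = _ ∷ X} {y} (there x∈) (here refl) _ =
  ∈-++⁺ˡ (subst (_∈ map (y ─_) X) (─-comm y x) (∈-map⁺ _ x∈))
∈-edges⁺ {X = _ ∷ X} (there x∈) (there y∈) x≢y = ∈-++⁺ʳ _ (∈-edges⁺ x∈ y∈ x≢y)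

∈-edges⁻′ : ∀ {e} → Unique X → e ∈ edges X →
            ∃₂ λ x y → e ≡ x ─ y × x ∈ X × y ∈ X × x ≢ y
∈-edges⁻′ {x ∷ X} X! e∈ with ∈-++⁻ (map (x ─_) X) e∈
... | inj₁ e∈star with y , y∈ , refl ← ∈-map⁻ _ e∈star =
  x , y , refl , here refl , there y∈ , λ { refl → Unique.Unique[x∷xs]⇒x∉xs X! y∈ }
∈-edges⁻′ {x ∷ X} (_ ∷ X!) e∈ | inj₂ e∈X with u , w , eq , u∈ , w∈ , u≢w ← ∈-edges⁻′ X! e∈X =
  u , w , eq , there u∈ , there w∈ , u≢w

∈-edges⁻ : Unique X → x ─ y ∈ edges X → x ∈ X × y ∈ X × x ≢ y
∈-edges⁻ X! e∈ with _ , _ , eq , u∈ , w∈ , u≢w ← ∈-edges⁻′ X! e∈ with ─-injective eq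
... | inj₁ (refl , refl) = u∈ , w∈ , u≢w
... | inj₂ (refl , refl) = w∈ , u∈ , u≢w ∘ sym

edges-unique : Unique X → Unique (edges X)
edges-unique {[]}    []       = []
edges-unique {x ∷ X} X!@(_ ∷ X′!) =
  Unique.++⁺ (Unique.map⁺ ─-cancelˡ X′!) (edges-unique X′!) disjoint
  where
  disjoint : Disjoint (map (x ─_) X) (edges X)
  disjoint (e∈star , e∈X) with y , _ , refl ← ∈-map⁻ _ e∈star =
    Unique.Unique[x∷xs]⇒x∉xs X! (proj₁ (∈-edges⁻ X′! e∈X))

edges-++ : ∀ N X → ∃ λ es → edges (N ++ X) ≡ es ++ edges X
edges-++ []      X = [] , refl
edges-++ (x ∷ N) X with es , eq ← edges-++ N X =
  map (x ─_) (N ++ X) ++ es ,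
  trans (cong (map (x ─_) (N ++ X) ++_) eq) (sym (++-assoc (map (x ─_) (N ++ X)) es _))

-- The binomial coefficient `n` over 2, the number of edges on `n` points; the index is shifted by
-- one against the usual triangular numbers.
tri : ℕ → ℕ
tri zero    = 0
tri (suc n) = n + tri n

length-edges : ∀ X → length (edges X) ≡ tri (length X)
length-edges []      = refl
length-edges (x ∷ X) =
  trans (length-++ (map (x ─_) X)) (cong₂ _+_ (length-map _ X) (length-edges X))

-- Designs as lists of labellings

map-unique : {C : Set} {f : A → B} {g : A → C} {xs : List A} →
  (∀ {x y} → x ∈ xs → y ∈ xs → f x ≡ f y → g x ≡ g y) →
  Unique (map g xs) → Unique (map f xs)
map-unique {xs = []}     _   _          = []
map-unique {xs = x ∷ xs} inj (g∉ ∷ gxs!) =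
  All.map⁺ (All.tabulate λ y∈ fx≡fy →
    All.lookup (All.map⁻ g∉) y∈ (inj (here refl) (there y∈) fx≡fy))
  ∷ map-unique (λ x∈ y∈ → inj (there x∈) (there y∈)) gxs!

map-injective-on : {f : A → B} {xs : List A} → Unique (map f xs) →
  ∀ {x y} → x ∈ xs → y ∈ xs → f x ≡ f y → x ≡ y
map-injective-on _         (here refl) (here refl) _  = refl
map-injective-on (f∉ ∷ _)  (here refl) (there y∈)  eq = contradiction eq (All.lookup (All.map⁻ f∉) y∈)
map-injective-on (f∉ ∷ _)  (there x∈)  (here refl) eq = contradiction (sym eq) (All.lookup (All.map⁻ f∉) x∈)
map-injective-on (_ ∷ fxs!) (there x∈) (there y∈)  eq = map-injective-on fxs! x∈ y∈ eq

preimage : (ℕ → ℕ) → List ℕ → ℕ → ℕ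
-- The default is reached only outside the image of the pattern, where the values of an isomorphism
-- are irrelevant.
preimage φ []       y = 0
preimage φ (p ∷ ps) y with φ p ≟ y
... | yes _ = p
... | no  _ = preimage φ ps y

preimage-inverse : ∀ {φ ps p} → Unique (map φ ps) → p ∈ ps → preimage φ ps (φ p) ≡ p
preimage-inverse {φ} {q ∷ ps} {p} φ! p∈ with φ q ≟ φ p
... | yes eq = map-injective-on φ! (here refl) p∈ eq
preimage-inverse {φ} {q ∷ ps} φ! (here refl) | no neq = contradiction refl neq
preimage-inverse {φ} {q ∷ ps} (_ ∷ φ!) (there p∈) | no neq = preimage-inverse φ! p∈

Adjacent : List (ℕ × ℕ) → ℕ → ℕ → Set
Adjacent E x y = (x , y) ∈ E ⊎ (y , x) ∈ E

adjacent⁺ : ∀ {E} → x ─ y ∈ map (uncurry _─_) E → Adjacent E x y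
adjacent⁺ e∈ with _ , pq∈ , eq ← ∈-map⁻ _ e∈ with ─-injective eq
... | inj₁ (refl , refl) = inj₁ pq∈
... | inj₂ (refl , refl) = inj₂ pq∈

adjacent⁻ : ∀ {E} → Adjacent E x y → x ─ y ∈ map (uncurry _─_) E
adjacent⁻ (inj₁ xy∈) = ∈-map⁺ _ xy∈
adjacent⁻ {x} {y} {E} (inj₂ yx∈) =
  subst (_∈ map (uncurry _─_) E) (─-comm y x) (∈-map⁺ _ yx∈)

-- A labelling places a pattern graph on ℕ; only its values on the vertices of the pattern matter.
Labelling : Set
Labelling = ℕ → ℕ

placed : List (ℕ × ℕ) → Labelling → List Edge
placed E φ = map (uncurry _─_) (map (Product.map φ φ) E)

∈-placed⁺ : ∀ {E p q} φ → Adjacent E p q → φ p ─ φ q ∈ placed E φ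
∈-placed⁺ φ = adjacent⁻ ∘ [ inj₁ ∘ ∈-map⁺ (Product.map φ φ) , inj₂ ∘ ∈-map⁺ (Product.map φ φ) ]′

∈-placed⁻ : ∀ {E} φ → x ─ y ∈ placed E φ → ∃₂ λ p q → Adjacent E p q × x ≡ φ p × y ≡ φ q
∈-placed⁻ φ e∈ with adjacent⁺ e∈
... | inj₁ xy∈ with (p , q) , pq∈ , refl ← ∈-map⁻ (Product.map φ φ) xy∈ = p , q , inj₁ pq∈ , refl , refl
... | inj₂ yx∈ with (p , q) , pq∈ , refl ← ∈-map⁻ (Product.map φ φ) yx∈ = q , p , inj₂ pq∈ , refl , refl

-- No vertex of the pattern is isolated, so the vertices of a placed block lie in `Y` as soon as its
-- edges do. The vertex `p₀` provides an edge by which equal blocks are recognised as one.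
module Pattern
  (P : List ℕ) (P! : Unique P) (E : List (ℕ × ℕ)) (valid : All (ValidEdge P) E)
  (E! : Unique (map (uncurry _─_) E))
  {p₀ : ℕ} (p₀∈ : p₀ ∈ P) (incident : ∀ {p} → p ∈ P → ∃ λ q → Adjacent E p q)
  where

  Γ : Graph
  Γ = fromEdges P P! E valid

  image : (φ : Labelling) → Unique (map φ P) → Graph
  image φ φ! = fromEdges (map φ P) φ! (map (Product.map φ φ) E)
    (All.map⁺ (All.map
      (λ (p∈ , q∈ , p≢q) → ∈-map⁺ φ p∈ , ∈-map⁺ φ q∈ , p≢q ∘ map-injective-on φ! p∈ q∈) valid))

  image≅Γ : (φ : Labelling) (φ! : Unique (map φ P)) → image φ φ! ≅ Γ
  image≅Γ φ φ! = record
    { to      = preimage φ P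
    ; from    = φ
    ; to-∈    = λ x∈ → case (∈-map⁻ φ x∈)
    ; from-∈  = ∈-map⁺ φ
    ; from-to = λ x∈ → from-to (∈-map⁻ φ x∈)
    ; to-from = preimage-inverse φ!
    ; to-adj  = λ x∈ y∈ → to-adj (∈-map⁻ φ x∈) (∈-map⁻ φ y∈)
    }
    where
    case : (∃ λ p → p ∈ P × x ≡ φ p) → preimage φ P x ∈ P
    case (p , p∈ , refl) = subst (_∈ P) (sym (preimage-inverse φ! p∈)) p∈
    from-to : (∃ λ p → p ∈ P × x ≡ φ p) → φ (preimage φ P x) ≡ x
    from-to (p , p∈ , refl) = cong φ (preimage-inverse φ! p∈)
    reflect : ∀ {p q} → p ∈ P → q ∈ P → (φ p , φ q) ∈ map (Product.map φ φ) E → (p , q) ∈ E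
    reflect p∈ q∈ e∈ with (p′ , q′) , e′∈ , eq ← ∈-map⁻ (Product.map φ φ) e∈
      with p′∈ , q′∈ , _ ← All.lookup valid e′∈
      with refl ← map-injective-on φ! p∈ p′∈ (cong proj₁ eq)
         | refl ← map-injective-on φ! q∈ q′∈ (cong proj₂ eq) = e′∈
    to-adj : (∃ λ p → p ∈ P × x ≡ φ p) → (∃ λ q → q ∈ P × y ≡ φ q) →
             Adj (image φ φ!) x y ⇔ Adj Γ (preimage φ P x) (preimage φ P y)
    to-adj (p , p∈ , refl) (q , q∈ , refl)
      rewrite preimage-inverse φ! p∈ | preimage-inverse φ! q∈ = mk⇔
        [ inj₁ ∘ reflect p∈ q∈ , inj₂ ∘ reflect q∈ p∈ ]′
        [ inj₁ ∘ ∈-map⁺ _ , inj₂ ∘ ∈-map⁺ _ ]′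

  module _ {Y : List ℕ} (Y! : Unique Y) (Φ : List Labelling)
           (Φ! : ∀ {φ} → φ ∈ Φ → Unique (map φ P))
           (Φ↭ : concatMap (placed E) Φ ↭ edges Y)
           -- A design has to exhibit a copy of `Γ` in `K`; a listed labelling provides it.
           {φ₀ : Labelling} (φ₀∈ : φ₀ ∈ Φ)
    where

    private
      K = complete Y Y!

      block : Fin (length Φ) → Graph
      block i = image (lookup Φ i) (Φ! (∈-lookup {xs = Φ} i))

      Φ-unique : Unique (concatMap (placed E) Φ)
      Φ-unique = unique-↭ (↭-sym Φ↭) (edges-unique Y!)

      placed⇒K : ∀ {φ} → φ ∈ Φ → x ─ y ∈ placed E φ → Adj K x y
      placed⇒K φ∈ e∈ = ∈-edges⁻ Y! (∈-resp-↭ Φ↭ (concatMap-∈ (placed E) φ∈ e∈))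

      image⊑K : ∀ {φ} (φ∈ : φ ∈ Φ) → image φ (Φ! φ∈) ⊑ K
      image⊑K {φ} φ∈ = record
        { V-⊆   = λ v∈ → vertex (∈-map⁻ φ v∈)
        ; Adj-⊆ = λ xy → placed⇒K φ∈ (adjacent⁻ xy)
        }
        where
        vertex : (∃ λ p → p ∈ P × x ≡ φ p) → x ∈ Y
        vertex (p , p∈ , refl) with q , pq ← incident p∈ =
          proj₁ (placed⇒K {x = φ p} {φ q} φ∈ (∈-placed⁺ φ pq))

      same-block : ∀ {i j} → Adj (block i) x y → Adj (block j) x y → i ≡ j
      same-block {i = i} {j} xyᵢ xyⱼ =
        concatMap-index-unique (placed E) Φ Φ-unique i j (adjacent⁻ xyᵢ) (adjacent⁻ xyⱼ)

      distinct : ∀ {i j} → block i ≈ block j → i ≡ j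
      distinct {i} (Bᵢ⊑Bⱼ , _) with q , p₀q ← incident p₀∈ =
        let xyᵢ = adjacent⁺ (∈-placed⁺ (lookup Φ i) p₀q) in same-block xyᵢ (_⊑_.Adj-⊆ Bᵢ⊑Bⱼ xyᵢ)

    toDesign : Design K Γ
    toDesign = record
      { Γ≲K       = image φ₀ (Φ! φ₀∈) , image⊑K φ₀∈ , image≅Γ φ₀ (Φ! φ₀∈)
      ; size      = length Φ
      ; block     = block
      ; distinct  = distinct
      ; subgraph  = λ i → image⊑K (∈-lookup {xs = Φ} i)
      ; copy      = λ i → image≅Γ _ _
      ; partition = λ {x} {y} (x∈ , y∈ , x≢y) →
          let any = ∈-concatMap⁻ (placed E) {xs = Φ} (∈-resp-↭ (↭-sym Φ↭) (∈-edges⁺ x∈ y∈ x≢y))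
              xyᵢ = adjacent⁺ {x} {y} (lookup-index any)
          in Any.index any , xyᵢ , λ xyⱼ → same-block xyᵢ xyⱼ
      }

  module _ {Y : List ℕ} (Y! : Unique Y) (𝓑 : Design (complete Y Y!) Γ) where
    open Design 𝓑
    private module Copy i = _≅_ (copy i)

    labels : Fin size → Labelling
    labels i = Copy.from i

    labels-∈ : ∀ {p} i → p ∈ P → labels i p ∈ V (block i)
    labels-∈ i = Copy.from-∈ i

    labels-injective : ∀ i {p q} → p ∈ P → q ∈ P → labels i p ≡ labels i q → p ≡ q
    labels-injective i p∈ q∈ eq =
      trans (sym (Copy.to-from i p∈)) (trans (cong (Copy.to i) eq) (Copy.to-from i q∈))

    V-block : ∀ i → x ∈ V (block i) → x ∈ map (labels i) P
    V-block i x∈ = subst (_∈ map (labels i) P) (Copy.from-to i x∈) (∈-map⁺ _ (Copy.to-∈ i x∈))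

    placed⇒adj : ∀ i → x ─ y ∈ placed E (labels i) → Adj (block i) x y
    placed⇒adj i e∈ with p , q , pq , refl , refl ← ∈-placed⁻ (labels i) e∈ =
      Equivalence.from (Copy.to-adj i (labels-∈ i p∈) (labels-∈ i q∈))
        (subst₂ (Adj Γ) (sym (Copy.to-from i p∈)) (sym (Copy.to-from i q∈)) pq)
      where
      p∈ = adj⇒∈ Γ pq
      q∈ = adj⇒∈ Γ (adj-sym Γ {p} {q} pq)

    adj⇒placed : ∀ i → Adj (block i) x y → x ─ y ∈ placed E (labels i)
    adj⇒placed i xy =
      subst₂ (λ x y → x ─ y ∈ placed E (labels i)) (Copy.from-to i x∈) (Copy.from-to i y∈)
        (∈-placed⁺ (labels i) (Equivalence.to (Copy.to-adj i x∈ y∈) xy))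
      where
      x∈ = adj⇒∈ (block i) xy
      y∈ = adj⇒∈ (block i) (adj-sym (block i) xy)

    placed-unique : ∀ i → Unique (placed E (labels i))
    placed-unique i = subst Unique (map-∘ E) (map-unique injective E!)
      where
      injective : ∀ {e e′} → e ∈ E → e′ ∈ E →
        uncurry _─_ (Product.map (labels i) (labels i) e) ≡ uncurry _─_ (Product.map (labels i) (labels i) e′) →
        uncurry _─_ e ≡ uncurry _─_ e′
      injective {p , q} {p′ , q′} e∈ e′∈ eq
        with p∈ , q∈ , _ ← All.lookup valid e∈ | p′∈ , q′∈ , _ ← All.lookup valid e′∈
        with ─-injective eq
      ... | inj₁ (pp′ , qq′) = cong₂ _─_ (labels-injective i p∈ p′∈ pp′) (labels-injective i q∈ q′∈ qq′)
      ... | inj₂ (pq′ , qp′) = trans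
        (cong₂ _─_ (labels-injective i p∈ q′∈ pq′) (labels-injective i q∈ p′∈ qp′)) (─-comm q′ p′)

    -- In `partition`, existence makes the placed edges cover `edges Y`, and uniqueness makes
    -- different blocks disjoint. Both lists are then free of repetitions and have the same members.
    labels-↭ : concatMap (placed E) (tabulate labels) ↭ edges Y
    labels-↭ = subst (_↭ edges Y) (cong concat (sym (map-tabulate labels (placed E))))
      (mutual-⊆⇒↭ (edges-unique Y!)
        (Unique.concat⁺ (All.tabulate⁺ placed-unique) (AllPairs.tabulate⁺ disjoint))
        covered inside)
      where
      unsorted : ∀ {e} i → e ∈ placed E (labels i) → ∃₂ λ x y → e ≡ x ─ y × Adj (block i) x y
      unsorted i e∈ with (x , y) , _ , refl ← ∈-map⁻ _ e∈ = x , y , refl , placed⇒adj i e∈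
      disjoint : ∀ {i j} → i ≢ j → Disjoint (placed E (labels i)) (placed E (labels j))
      disjoint {i} {j} i≢j (e∈ᵢ , e∈ⱼ)
        with x , y , refl , xyᵢ ← unsorted i e∈ᵢ
        with _ , _ , only ← partition (_⊑_.Adj-⊆ (subgraph i) xyᵢ) =
        i≢j (trans (sym (only xyᵢ)) (only (placed⇒adj j e∈ⱼ)))
      covered : edges Y ⊆ concat (tabulate (placed E ∘ labels))
      covered e∈ with x , y , refl , x∈ , y∈ , x≢y ← ∈-edges⁻′ Y! e∈
        with i , xyᵢ , _ ← partition (x∈ , y∈ , x≢y) =
        ∈-concat⁺′ (adj⇒placed i xyᵢ) (∈-tabulate⁺ i)
      inside : concat (tabulate (placed E ∘ labels)) ⊆ edges Y
      inside e∈ with _ , e∈es , es∈ ← ∈-concat⁻′ _ e∈ with i , refl ← ∈-tabulate⁻ {f = placed E ∘ labels} es∈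
        with x , y , refl , xyᵢ ← unsorted i e∈es
        with x∈ , y∈ , x≢y ← _⊑_.Adj-⊆ (subgraph i) xyᵢ = ∈-edges⁺ x∈ y∈ x≢y

module P3 where
  private
    P : List ℕ
    P = 0 ∷ 1 ∷ 2 ∷ []
    E : List (ℕ × ℕ)
    E = (0 , 1) ∷ (1 , 2) ∷ []
    incident : ∀ {p} → p ∈ P → ∃ λ q → Adjacent E p q
    incident (here refl)                 = 1 , inj₁ (here refl)
    incident (there (here refl))         = 0 , inj₂ (here refl)
    incident (there (there (here refl))) = 1 , inj₂ (there (here refl))
  -- With the lists and decided proofs used for `P₃`, the graph `Γ` unfolds to `P₃` itself; likewise
  -- for `kite` below.
  open Pattern P (from-yes (unique? _≟_ P)) E (from-yes (validEdges? P E))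
    (from-yes (unique? (≡-dec _≟_ _≟_) (map (uncurry _─_) E)))
    (here refl)
    incident public

module Kite where
  private
    P : List ℕ
    P = 0 ∷ 1 ∷ 2 ∷ 3 ∷ []
    E : List (ℕ × ℕ)
    E = (2 , 0) ∷ (2 , 1) ∷ (2 , 3) ∷ (0 , 1) ∷ []
    incident : ∀ {p} → p ∈ P → ∃ λ q → Adjacent E p q
    incident (here refl)                         = 2 , inj₂ (here refl)
    incident (there (here refl))                 = 2 , inj₂ (there (here refl))
    incident (there (there (here refl)))         = 0 , inj₁ (here refl)
    incident (there (there (there (here refl)))) = 2 , inj₂ (there (there (here refl)))
  open Pattern P (from-yes (unique? _≟_ P)) E (from-yes (validEdges? P E))
    (from-yes (unique? (≡-dec _≟_ _≟_) (map (uncurry _─_) E)))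
    (here refl)
    incident public

-- In a kite `φ 2` is the centre, of degree three, and `φ 3` the pendant vertex. The edges come in
-- the order ca, cb, cd, ab, on which the positional membership proofs rely.
pathEdges kiteEdges : Labelling → List Edge
pathEdges = placed ((0 , 1) ∷ (1 , 2) ∷ [])
kiteEdges = placed ((2 , 0) ∷ (2 , 1) ∷ (2 , 3) ∷ (0 , 1) ∷ [])

path : ℕ → ℕ → ℕ → Labelling
path x y z 0 = x
path x y z 1 = y
path x y z _ = z

kiteOn : ℕ → ℕ → ℕ → ℕ → Labelling
kiteOn a b c d 0 = a
kiteOn a b c d 1 = b
kiteOn a b c d 2 = c
kiteOn a b c d _ = d

module _ {Y : List ℕ} {Φ : List Labelling} {f : Labelling → List Edge}
         (Y! : Unique Y) (Φ↭ : concatMap f Φ ↭ edges Y) where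

  packed-edge : {φ : Labelling} → φ ∈ Φ → x ─ y ∈ f φ → x ∈ Y × y ∈ Y × x ≢ y
  packed-edge φ∈ e∈ = ∈-edges⁻ Y! (∈-resp-↭ Φ↭ (concatMap-∈ f φ∈ e∈))

  packed-unique : {φ : Labelling} → φ ∈ Φ → Unique (f φ)
  packed-unique = concatMap-unique f (unique-↭ (↭-sym Φ↭) (edges-unique Y!))

-- Adjacent labels differ because `edges Y` has no loops; the two ends differ because otherwise one
-- edge would be listed twice. The same reasoning serves for kites.
path-vertices-unique : ∀ {Φ φ} → Unique Y → concatMap pathEdges Φ ↭ edges Y → φ ∈ Φ →
                       Unique (map φ (0 ∷ 1 ∷ 2 ∷ []))
path-vertices-unique {φ = φ} Y! Φ↭ φ∈ with packed-unique Y! Φ↭ φ∈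
... | (xy≢yz ∷ []) ∷ _ =
  (x≢y ∷ (λ x≡z → xy≢yz (trans (─-comm _ _) (cong (φ 1 ─_) x≡z))) ∷ []) ∷ (y≢z ∷ []) ∷ [] ∷ []
  where
  x≢y = proj₂ (proj₂ (packed-edge Y! Φ↭ φ∈ (here refl)))
  y≢z = proj₂ (proj₂ (packed-edge Y! Φ↭ φ∈ (there (here refl))))

kite-vertices-unique : ∀ {Φ φ} → Unique Y → concatMap kiteEdges Φ ↭ edges Y → φ ∈ Φ →
                       Unique (map φ (0 ∷ 1 ∷ 2 ∷ 3 ∷ []))
kite-vertices-unique {φ = φ} Y! Φ↭ φ∈ with packed-unique Y! Φ↭ φ∈
... | (_ ∷ ca≢cd ∷ _) ∷ (cb≢cd ∷ _) ∷ _ =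
  (a≢b ∷ c≢a ∘ sym ∷ ca≢cd ∘ cong (φ 2 ─_) ∷ []) ∷
  (c≢b ∘ sym ∷ cb≢cd ∘ cong (φ 2 ─_) ∷ []) ∷
  (c≢d ∷ []) ∷ [] ∷ []
  where
  c≢a = proj₂ (proj₂ (packed-edge Y! Φ↭ φ∈ (here refl)))
  c≢b = proj₂ (proj₂ (packed-edge Y! Φ↭ φ∈ (there (here refl))))
  c≢d = proj₂ (proj₂ (packed-edge Y! Φ↭ φ∈ (there (there (here refl)))))
  a≢b = proj₂ (proj₂ (packed-edge Y! Φ↭ φ∈ (there (there (there (here refl))))))

kiteDesign : ∀ {Φ φ₀} → Unique Y → length Y ≡ n → concatMap kiteEdges Φ ↭ edges Y → φ₀ ∈ Φ →
             DesignOfOrder kite n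
kiteDesign {Y} {Φ = Φ} Y! len Φ↭ φ₀∈ = record
  { points  = Y
  ; points! = Y!
  ; order   = len
  ; design  = Kite.toDesign Y! Φ (kite-vertices-unique Y! Φ↭) Φ↭ φ₀∈
  }

HasPath : Graph → Labelling → Set
HasPath G φ = Adj G (φ 0) (φ 1) × Adj G (φ 1) (φ 2)

image⊑ : ∀ {G φ} φ! → HasPath G φ → P3.image φ φ! ⊑ G
image⊑ {G} φ! (xy , yz) = record
  { V-⊆ = λ { (here refl) → adj⇒∈ G xy
            ; (there (here refl)) → adj⇒∈ G yz
            ; (there (there (here refl))) → adj⇒∈ G (adj-sym G yz) }
  ; Adj-⊆ = λ { (inj₁ (here refl)) → xy
              ; (inj₁ (there (here refl))) → yz
              ; (inj₂ (here refl)) → adj-sym G xy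
              ; (inj₂ (there (here refl))) → adj-sym G yz }
  }

-- It suffices to find, in each block, some path of the packing: the position of that path in the
-- list is the value of the down-link.
downLinkable : ∀ {Γ Φ φ₀} (𝓑 : DesignOfOrder Γ v) →
  Unique Y → length Y ≡ n → concatMap pathEdges Φ ↭ edges Y → φ₀ ∈ Φ →
  (∀ i → ∃ λ φ → φ ∈ Φ × HasPath (Design.block (DesignOfOrder.design 𝓑) i) φ) →
  DownLinkable 𝓑 n
downLinkable {Y = Y} {Φ = Φ} 𝓑 Y! len Φ↭ φ₀∈ link = record
    { points  = Y
    ; points! = Y!
    ; order   = len
    ; design  = P3.toDesign Y! Φ (path-vertices-unique Y! Φ↭) Φ↭ φ₀∈
    } , record
    { f   = λ i → Any.index (proj₁ (proj₂ (link i)))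
    ; f-⊑ = λ i → let φ , φ∈ , φ⊑ = link i in
        image⊑ {φ = lookup Φ (Any.index φ∈)} _ (subst (HasPath (Design.block (DesignOfOrder.design 𝓑) i)) (lookup-index φ∈) φ⊑)
    }

-- Decomposition into paths

-- The head of a vertex list with several entries is a leaf, so structural recursion strips leaves
-- before their parents and ends at the root, which stands last.
data Tree : List ℕ → Set where
  root : ∀ r → Tree [ r ]
  leaf : ∀ u {p} → p ∈ vs → Tree vs → Tree (u ∷ vs)

treeEdges : Tree vs → List Edge
treeEdges (root r)         = []
treeEdges (leaf u {p} _ T) = p ─ u ∷ treeEdges T

parents-∈ : ∀ {e} (T : Tree vs) → e ∈ treeEdges T → ∃₂ λ x y → e ≡ x ─ y × x ∈ vs × y ∈ vs
parents-∈ (leaf u {p} p∈ T) (here refl) = p , u , refl , there p∈ , here refl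
parents-∈ (leaf u _ T) (there e∈) with x , y , eq , x∈ , y∈ ← parents-∈ T e∈ =
  x , y , eq , there x∈ , there y∈

treeEdges-unique : (T : Tree vs) → Unique vs → Unique (treeEdges T)
treeEdges-unique (root r) _ = []
treeEdges-unique {u ∷ vs} (leaf u {p} _ T) vs!@(_ ∷ vs′!) =
  All.¬Any⇒All¬ _ new ∷ treeEdges-unique T vs′!
  where
  u∉vs = Unique.Unique[x∷xs]⇒x∉xs vs!
  new : p ─ u ∉ treeEdges T
  new e∈ with x , y , eq , x∈ , y∈ ← parents-∈ T e∈ with ─-injective eq
  ... | inj₁ (_ , refl) = u∉vs y∈
  ... | inj₂ (_ , refl) = u∉vs x∈

-- Any two edges at `u` form a path with middle vertex `u`; an edge is left over only for parity.
pair-star : ∀ u ns → ∃₂ λ Φ m → map (u ─_) ns ↭ concatMap pathEdges Φ ++ map (u ─_) (fromMaybe m)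
pair-star u []           = [] , nothing , ↭-refl
pair-star u (x ∷ [])     = [] , just x , ↭-refl
pair-star u (x ∷ y ∷ ns) with Φ , m , ns↭ ← pair-star u ns =
  path x u y ∷ Φ , m ,
  ↭-trans (↭-reflexive (cong (_∷ _) (─-comm u x))) (prep _ (prep _ ns↭))

-- The first component of each listed pair is the vertex at which the edge is to be paired up.
split-centre : ∀ {u} O → All (λ (c , _) → c ∈ u ∷ vs) O → ∃₂ λ ns O′ →
  map (uncurry _─_) O ↭ map (u ─_) ns ++ map (uncurry _─_) O′ × All (λ (c , _) → c ∈ vs) O′
split-centre [] [] = [] , [] , ↭-refl , []
split-centre ((c , x) ∷ O) (c∈ ∷ O∈) with ns , O′ , O↭ , O′∈ ← split-centre O O∈ | c∈
... | here refl = x ∷ ns , O′ , prep _ O↭ , O′∈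
... | there c∈′ = ns , (c , x) ∷ O′ ,
  ↭-trans (prep _ O↭) (↭-sym (↭.shift _ (map (_ ─_) ns) _)) , c∈′ ∷ O′∈

-- Leaves are removed one at a time: the edges assigned to a leaf are paired up,
-- and the edge to its parent absorbs an odd one or is passed on to the parent.
tree-decomposition : (T : Tree vs) (O : List (ℕ × ℕ)) → All (λ (c , _) → c ∈ vs) O →
  ∃₂ λ Φ m → treeEdges T ++ map (uncurry _─_) O ↭ concatMap pathEdges Φ ++ fromMaybe m
tree-decomposition (root r) O O∈ with split-centre O O∈
-- At the root there is no parent edge to absorb an odd edge, so this is where the single unpaired
-- edge may arise.
... | ns , [] , O↭ , [] with pair-star r ns
...   | Φ , nothing , ns↭ = Φ , nothing , ↭-trans O↭ (↭-trans (↭.++-identityʳ _) ns↭)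
...   | Φ , just x  , ns↭ = Φ , just (r ─ x) , ↭-trans O↭ (↭-trans (↭.++-identityʳ _) ns↭)
tree-decomposition (leaf u {p} p∈ T) O O∈ with split-centre O O∈
... | ns , O′ , O↭ , O′∈ with pair-star u ns
...   | Φ , nothing , ns↭ with Ψ , m , T↭ ← tree-decomposition T ((p , u) ∷ O′) (p∈ ∷ O′∈) =
  Φ ++ Ψ , m , (begin
    [ p ─ u ] ++ treeEdges T ++ map (uncurry _─_) O
      ↭⟨ ↭.++⁺ˡ ([ p ─ u ] ++ treeEdges T) (↭-trans O↭ (↭.++⁺ʳ _ (↭-trans ns↭ (↭.++-identityʳ _)))) ⟩
    ([ p ─ u ] ++ treeEdges T) ++ concatMap pathEdges Φ ++ map (uncurry _─_) O′
      ↭⟨ solve 4 (λ e t φ o → (e ⊕ t) ⊕ φ ⊕ o ⊜ φ ⊕ t ⊕ e ⊕ o) ↭-refl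
           [ p ─ u ] (treeEdges T) (concatMap pathEdges Φ) (map (uncurry _─_) O′) ⟩
    concatMap pathEdges Φ ++ treeEdges T ++ [ p ─ u ] ++ map (uncurry _─_) O′
      ↭⟨ ↭.++⁺ˡ (concatMap pathEdges Φ) T↭ ⟩
    concatMap pathEdges Φ ++ concatMap pathEdges Ψ ++ fromMaybe m
      ↭⟨ ↭.++-assoc (concatMap pathEdges Φ) _ _ ⟨
    (concatMap pathEdges Φ ++ concatMap pathEdges Ψ) ++ fromMaybe m
      ≡⟨ cong (_++ fromMaybe m) (concatMap-++ pathEdges Φ Ψ) ⟨
    concatMap pathEdges (Φ ++ Ψ) ++ fromMaybe m ∎)
  where open PermutationReasoning
...   | Φ , just x , ns↭ with Ψ , m , T↭ ← tree-decomposition T O′ O′∈ =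
  path p u x ∷ Φ ++ Ψ , m , (begin
    [ p ─ u ] ++ treeEdges T ++ map (uncurry _─_) O
      ↭⟨ ↭.++⁺ˡ ([ p ─ u ] ++ treeEdges T) (↭-trans O↭ (↭.++⁺ʳ _ ns↭)) ⟩
    ([ p ─ u ] ++ treeEdges T) ++ (concatMap pathEdges Φ ++ [ u ─ x ]) ++ map (uncurry _─_) O′
      ↭⟨ solve 5 (λ e t φ x o → (e ⊕ t) ⊕ (φ ⊕ x) ⊕ o ⊜ (e ⊕ x ⊕ φ) ⊕ t ⊕ o) ↭-refl
           [ p ─ u ] (treeEdges T) (concatMap pathEdges Φ) [ u ─ x ] (map (uncurry _─_) O′) ⟩
    concatMap pathEdges (path p u x ∷ Φ) ++ treeEdges T ++ map (uncurry _─_) O′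
      ↭⟨ ↭.++⁺ˡ (concatMap pathEdges (path p u x ∷ Φ)) T↭ ⟩
    concatMap pathEdges (path p u x ∷ Φ) ++ concatMap pathEdges Ψ ++ fromMaybe m
      ↭⟨ ↭.++-assoc (concatMap pathEdges (path p u x ∷ Φ)) _ _ ⟨
    (concatMap pathEdges (path p u x ∷ Φ) ++ concatMap pathEdges Ψ) ++ fromMaybe m
      ≡⟨ cong (_++ fromMaybe m) (concatMap-++ pathEdges (path p u x ∷ Φ) Ψ) ⟨
    concatMap pathEdges (path p u x ∷ Φ ++ Ψ) ++ fromMaybe m ∎)
  where open PermutationReasoning

-- An edge outside the tree may be paired up at either endpoint. Listed edges are sorted, so each
-- already has the form of a pair assigned to its smaller endpoint.
∈-edges-sorted : ∀ {e} → Unique Y → e ∈ edges Y → uncurry _─_ e ≡ e × proj₁ e ∈ Y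
∈-edges-sorted Y! e∈ with x , y , refl , x∈ , y∈ , _ ← ∈-edges⁻′ Y! e∈ with endpoints x y
... | inj₁ eq = trans (cong (uncurry _─_) (sym eq)) refl , subst (_∈ _) (cong proj₁ eq) x∈
... | inj₂ eq = trans (cong (uncurry _─_) (sym eq)) (─-comm y x) , subst (_∈ _) (cong proj₁ eq) y∈

length-pathEdges : ∀ Φ → length (concatMap pathEdges Φ) ≡ length Φ * 2
length-pathEdges Φ = length-concatMap pathEdges 2 Φ λ _ → refl

completion : ∀ {Φ R} → Unique Y → 2 ∣ tri (length Y) → (T : Tree Y) →
  edges Y ↭ concatMap pathEdges Φ ++ R → treeEdges T ⊆ R →
  ∃ λ Ψ → concatMap pathEdges (Φ ++ Ψ) ↭ edges Y
completion {Y} {Φ} {R} Y! even T Y↭ T⊆R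
  with O , R↭ ← unique-⊆⇒↭ (treeEdges-unique T Y!) T⊆R = result (tree-decomposition T O (All.map proj₂ sorted))
  where
  sorted : All (λ e → uncurry _─_ e ≡ e × proj₁ e ∈ Y) O
  sorted = All.tabulate λ e∈ → ∈-edges-sorted Y!
    (∈-resp-↭ (↭-sym Y↭) (∈-++⁺ʳ (concatMap pathEdges Φ) (∈-resp-↭ (↭-sym R↭) (∈-++⁺ʳ (treeEdges T) e∈))))
  total : ∀ Ψ m → treeEdges T ++ map (uncurry _─_) O ↭ concatMap pathEdges Ψ ++ fromMaybe m →
          edges Y ↭ concatMap pathEdges (Φ ++ Ψ) ++ fromMaybe m
  total Ψ m T↭ = begin
    edges Y                                        ↭⟨ Y↭ ⟩
    concatMap pathEdges Φ ++ R                     ↭⟨ ↭.++⁺ˡ (concatMap pathEdges Φ) R↭ ⟩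
    concatMap pathEdges Φ ++ treeEdges T ++ O      ≡⟨ cong (λ es → concatMap pathEdges Φ ++ treeEdges T ++ es)
                                                        (map-id-local (All.map proj₁ sorted)) ⟨
    concatMap pathEdges Φ ++ treeEdges T ++ map (uncurry _─_) O
                                                   ↭⟨ ↭.++⁺ˡ (concatMap pathEdges Φ) T↭ ⟩
    concatMap pathEdges Φ ++ concatMap pathEdges Ψ ++ fromMaybe m
                                                   ↭⟨ ↭.++-assoc (concatMap pathEdges Φ) _ _ ⟨
    (concatMap pathEdges Φ ++ concatMap pathEdges Ψ) ++ fromMaybe m
                                                   ≡⟨ cong (_++ fromMaybe m) (concatMap-++ pathEdges Φ Ψ) ⟨
    concatMap pathEdges (Φ ++ Ψ) ++ fromMaybe m    ∎
    where open PermutationReasoning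
  result : (∃₂ λ Ψ m → treeEdges T ++ map (uncurry _─_) O ↭ concatMap pathEdges Ψ ++ fromMaybe m) →
           ∃ λ Ψ → concatMap pathEdges (Φ ++ Ψ) ↭ edges Y
  result (Ψ , nothing , T↭) = Ψ , ↭-sym (↭-trans (total Ψ nothing T↭) (↭.++-identityʳ _))
  -- An unpaired edge would make `tri (length Y)` one more than an even number.
  result (Ψ , just e , T↭) = contradiction (∣1⇒≡1 (∣m+n∣m⇒∣n
    (subst (2 ∣_) (trans (sym (length-edges Y)) (trans (↭-length (total Ψ (just e) T↭))
      (trans (length-++ (concatMap pathEdges (Φ ++ Ψ))) (cong (_+ 1) (length-pathEdges (Φ ++ Ψ)))))) even)
    (n∣m*n (length (Φ ++ Ψ))))) λ ()

-- Parity of the number of edges.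

tri-step : ∀ n → tri (4 + n) ≡ (2 * n + 3) * 2 + tri n
tri-step n = identity n (tri n)
  where
  identity : ∀ n t → 3 + n + (2 + n + (1 + n + (n + t))) ≡ (2 * n + 3) * 2 + t
  identity = solve-∀

-- Four further points add 4n + 6 edges, so the parity of `tri` has period 4 and only four values
-- need inspection.
tri-even⇒ : ∀ n → 2 ∣ tri n → n % 4 ≡ 0 ⊎ n % 4 ≡ 1
tri-even⇒ 0 _ = inj₁ refl
tri-even⇒ 1 _ = inj₂ refl
tri-even⇒ 2 2∣1 = contradiction (∣1⇒≡1 2∣1) λ ()
tri-even⇒ 3 2∣3 = contradiction (n∣m⇒m%n≡0 3 2 2∣3) λ ()
tri-even⇒ (suc (suc (suc (suc n)))) 2∣ = tri-even⇒ n
  (∣m+n∣m⇒∣n (subst (2 ∣_) (tri-step n) 2∣) (n∣m*n (2 * n + 3)))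

tri-even⇐ : ∀ n → n % 4 ≡ 0 ⊎ n % 4 ≡ 1 → 2 ∣ tri n
tri-even⇐ 0 _ = divides 0 refl
tri-even⇐ 1 _ = divides 0 refl
tri-even⇐ 2 (inj₁ ())
tri-even⇐ 2 (inj₂ ())
tri-even⇐ 3 (inj₁ ())
tri-even⇐ 3 (inj₂ ())
tri-even⇐ (suc (suc (suc (suc n)))) r = subst (2 ∣_) (sym (tri-step n))
  (∣m∣n⇒∣m+n (n∣m*n (2 * n + 3)) (tri-even⇐ n r))

-- Down-links of an arbitrary kite design.

chosen other : Labelling → Labelling
chosen φ = path (φ 0) (φ 1) (φ 2)
other  φ = path (φ 0) (φ 2) (φ 3)

kite↭ : ∀ φ → kiteEdges φ ↭ pathEdges (chosen φ) ++ pathEdges (other φ)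
kite↭ φ rewrite ─-comm (φ 2) (φ 0) | ─-comm (φ 2) (φ 1) =
  solve 4 (λ p q r s → p ⊕ q ⊕ r ⊕ s ⊜ s ⊕ q ⊕ p ⊕ r) ↭-refl
    [ φ 0 ─ φ 2 ] [ φ 1 ─ φ 2 ] [ φ 2 ─ φ 3 ] [ φ 0 ─ φ 1 ]

-- The centre `p` stands last because the root of a `Tree` does.
star : (p : ℕ) (Z : List ℕ) → Tree (Z ++ [ p ])
star p []      = root p
star p (z ∷ Z) = leaf z (∈-++⁺ʳ Z (here refl)) (star p Z)

starEdges : ∀ p Z → treeEdges (star p Z) ≡ map (p ─_) Z
starEdges p []      = refl
starEdges p (z ∷ Z) = cong (_ ∷_) (starEdges p Z)

edges-↭ : X ↭ Y → Unique X → edges X ↭ edges Y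
edges-↭ {X} {Y} X↭Y X! = mutual-⊆⇒↭ (edges-unique Y!) (edges-unique X!)
  (edges-⊆ Y! (∈-resp-↭ (↭-sym X↭Y))) (edges-⊆ X! (∈-resp-↭ X↭Y))
  where
  Y! = unique-↭ X↭Y X!
  edges-⊆ : ∀ {X Y} → Unique X → X ⊆ Y → edges X ⊆ edges Y
  edges-⊆ X! X⊆Y e∈ with x , y , refl , x∈ , y∈ , x≢y ← ∈-edges⁻′ X! e∈ = ∈-edges⁺ (X⊆Y x∈) (X⊆Y y∈) x≢y

module _ (𝓑 : DesignOfOrder kite v) (v>1 : v > 1) where
  open DesignOfOrder 𝓑
  open Design design using (size; block; partition)

  private
    labels = Kite.labels points! design

    someBlock : Fin size
    someBlock with points | points! | order | partition
    ... | [] | _ | refl | _ = contradiction v>1 λ ()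
    ... | _ ∷ [] | _ | refl | _ = contradiction v>1 λ { (s≤s ()) }
    ... | x ∷ y ∷ _ | (x≢y ∷ _) ∷ _ | _ | part = proj₁ (part (here refl , there (here refl) , x≢y))

    chosen-path : ∀ i → HasPath (block i) (chosen (labels i))
    chosen-path i = adj (there (there (there (here refl)))) ,
                    adj-sym (block i) (adj (there (here refl)))
      where
      adj : x ─ y ∈ kiteEdges (labels i) → Adj (block i) x y
      adj = Kite.placed⇒adj points! design i

    chosen-list other-list : List Labelling
    chosen-list = map chosen (tabulate labels)
    other-list = map other (tabulate labels)

    chosen-∈ : ∀ i → chosen (labels i) ∈ chosen-list
    chosen-∈ i = ∈-map⁺ chosen (∈-tabulate⁺ i)

    points↭ : edges points ↭ concatMap pathEdges chosen-list ++ concatMap pathEdges other-list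
    points↭ = begin
      edges points
        ↭⟨ Kite.labels-↭ points! design ⟨
      concatMap kiteEdges (tabulate labels)
        ↭⟨ concatMap-split kiteEdges (pathEdges ∘ chosen) (pathEdges ∘ other) (tabulate labels) (λ {φ} _ → kite↭ φ) ⟩
      concatMap (pathEdges ∘ chosen) (tabulate labels) ++ concatMap (pathEdges ∘ other) (tabulate labels)
        ≡⟨ cong₂ _++_ (concatMap-map pathEdges chosen (tabulate labels))
                      (concatMap-map pathEdges other (tabulate labels)) ⟨
      concatMap pathEdges chosen-list ++ concatMap pathEdges other-list ∎
      where open PermutationReasoning

  kite-downLink-same : DownLinkable 𝓑 v
  kite-downLink-same = downLinkable 𝓑 points! order
    (↭-trans (↭-reflexive (concatMap-++ pathEdges chosen-list other-list)) (↭-sym points↭))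
    (∈-++⁺ˡ (chosen-∈ someBlock))
    λ i → chosen (labels i) , ∈-++⁺ˡ (chosen-∈ i) , chosen-path i

  -- The new vertex p is joined to all others by edges outside the blocks, so these form a spanning tree.
  kite-downLink-larger : ∀ m → 2 ∣ tri (suc m + v) → DownLinkable 𝓑 (suc m + v)
  kite-downLink-larger m even with fresh points points! (suc m)
  ... | p ∷ N , len , p∷Z! with es , es-eq ← edges-++ N points =
    let Ψ , Ψ↭ = completion {Φ = chosen-list} Y! (subst (λ n → 2 ∣ tri n) (sym order′) even) (star p Z) Y↭ star⊆
    in downLinkable 𝓑 Y! order′ Ψ↭ (∈-++⁺ˡ (chosen-∈ someBlock))
         λ i → chosen (labels i) , ∈-++⁺ˡ (chosen-∈ i) , chosen-path i
    where
    Z = N ++ points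
    Y! : Unique (Z ++ [ p ])
    Y! = unique-↭ (↭.∷↭∷ʳ p Z) p∷Z!
    order′ : length (Z ++ [ p ]) ≡ suc m + v
    order′ = trans (sym (↭-length (↭.∷↭∷ʳ p Z))) (trans (length-++ (p ∷ N)) (cong₂ _+_ len order))
    Y↭ : edges (Z ++ [ p ]) ↭
         concatMap pathEdges chosen-list ++ map (p ─_) Z ++ es ++ concatMap pathEdges other-list
    Y↭ = begin
      edges (Z ++ [ p ])
        ↭⟨ edges-↭ (↭.∷↭∷ʳ p Z) p∷Z! ⟨
      map (p ─_) Z ++ edges Z
        ≡⟨ cong (map (p ─_) Z ++_) es-eq ⟩
      map (p ─_) Z ++ es ++ edges points
        ↭⟨ ↭.++⁺ˡ (map (p ─_) Z) (↭.++⁺ˡ es points↭) ⟩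
      map (p ─_) Z ++ es ++ concatMap pathEdges chosen-list ++ concatMap pathEdges other-list
        ↭⟨ solve 4 (λ a b c d → a ⊕ b ⊕ c ⊕ d ⊜ c ⊕ a ⊕ b ⊕ d) ↭-refl (map (p ─_) Z) es
             (concatMap pathEdges chosen-list) (concatMap pathEdges other-list) ⟩
      concatMap pathEdges chosen-list ++ map (p ─_) Z ++ es ++ concatMap pathEdges other-list ∎
      where open PermutationReasoning
    star⊆ : treeEdges (star p Z) ⊆ map (p ─_) Z ++ es ++ concatMap pathEdges other-list
    star⊆ e∈ = ∈-++⁺ˡ (subst (_ ∈_) (starEdges p Z) e∈)

  kite-downLink : n ≥ v → n % 4 ≡ 0 ⊎ n % 4 ≡ 1 → DownLinkable 𝓑 n
  kite-downLink n≥v r with k , refl ← m≤n⇒∃[o]m+o≡n n≥v rewrite +-comm v k with k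
  ... | zero  = kite-downLink-same
  ... | suc m = kite-downLink-larger m (tri-even⇐ (suc m + v) r)

-- Necessary conditions on the order of the P₃-design.

module _ {n : ℕ} (𝓑′ : DesignOfOrder P₃ n) where
  private
    module P = DesignOfOrder 𝓑′
    module D = Design P.design
    labels′ = P3.labels P.points! P.design

  P₃-order : n % 4 ≡ 0 ⊎ n % 4 ≡ 1
  P₃-order = tri-even⇒ n (divides (length (tabulate labels′)) (begin
    tri n                                              ≡⟨ cong tri P.order ⟨
    tri (length P.points)                              ≡⟨ length-edges P.points ⟨
    length (edges P.points)                            ≡⟨ ↭-length (P3.labels-↭ P.points! P.design) ⟨
    length (concatMap pathEdges (tabulate labels′))    ≡⟨ length-pathEdges (tabulate labels′) ⟩
    length (tabulate labels′) * 2                      ∎))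
    where open ≡-Reasoning

  module _ {v : ℕ} (𝓑 : DesignOfOrder kite v)
           (link : DownLink (DesignOfOrder.design 𝓑) P.design) where
    private
      module Q = DesignOfOrder 𝓑
      module K = Design Q.design
      open DownLink link

    -- All that the lower bounds use of a down-link: every block contains a path whose three
    -- vertices are points of the P₃-design.
    record LinkedPath (i : Fin K.size) : Set where
      field
        {p q r}     : ℕ
        p∈ : p ∈ P.points
        q∈ : q ∈ P.points
        r∈ : r ∈ P.points
        p≢q : p ≢ q
        q≢r : q ≢ r
        p≢r : p ≢ r
        pq : Adj (K.block i) p q
        qr : Adj (K.block i) q r

    linkedPath : ∀ i → LinkedPath i
    linkedPath i = record
      { p∈ = inP (here refl) ; q∈ = inP (there (here refl)) ; r∈ = inP (there (there (here refl)))
      ; p≢q = λ eq → contradiction (inj (here refl) (there (here refl)) eq) λ ()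
      ; q≢r = λ eq → contradiction (inj (there (here refl)) (there (there (here refl))) eq) λ ()
      ; p≢r = λ eq → contradiction (inj (here refl) (there (there (here refl))) eq) λ ()
      ; pq = _⊑_.Adj-⊆ (f-⊑ i) (P3.placed⇒adj P.points! P.design (f i) (here refl))
      ; qr = _⊑_.Adj-⊆ (f-⊑ i) (P3.placed⇒adj P.points! P.design (f i) (there (here refl)))
      }
      where
      inP = λ {a} a∈ → _⊑_.V-⊆ (D.subgraph (f i)) (P3.labels-∈ P.points! P.design {a} (f i) a∈)
      inj = λ {a} {b} → P3.labels-injective P.points! P.design (f i) {a} {b}

    -- Any two points of the kite design share a block, and a path leaves out only one of its vertices.
    missing-unique : x ∈ Q.points → y ∈ Q.points → x ∉ P.points → y ∉ P.points → x ≡ y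
    missing-unique {x} {y} x∈ y∈ x∉ y∉ with x ≟ y
    ... | yes x≡y = x≡y
    ... | no  x≢y with i , xy , _ ← K.partition (x∈ , y∈ , x≢y) = contradiction
      (unique-⊆⇒≤ {xs = x ∷ y ∷ p ∷ q ∷ r ∷ []}
        ((x≢y ∷ apart x∉ p∈ ∷ apart x∉ q∈ ∷ apart x∉ r∈ ∷ []) ∷
         (apart y∉ p∈ ∷ apart y∉ q∈ ∷ apart y∉ r∈ ∷ []) ∷ (p≢q ∷ p≢r ∷ []) ∷ (q≢r ∷ []) ∷ [] ∷ [])
        (λ u∈ → Kite.V-block Q.points! Q.design i (All.lookup five u∈)))
      (<⇒≱ ≤-refl)
      where
      open LinkedPath (linkedPath i)
      G = K.block i
      apart : ∀ {a b} → a ∉ P.points → b ∈ P.points → a ≢ b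
      apart a∉ b∈ refl = a∉ b∈
      five : All (_∈ V G) (x ∷ y ∷ p ∷ q ∷ r ∷ [])
      five = adj⇒∈ G xy ∷ adj⇒∈ G (adj-sym G xy) ∷ adj⇒∈ G pq ∷ adj⇒∈ G qr ∷ adj⇒∈ G (adj-sym G qr) ∷ []

    -- If n + 1 < v, two points are missing: the second is found by applying the pigeonhole
    -- principle again, after adding the first to the list.
    order-bound : n ≥ v ∸ 1
    order-bound with suc n <? v
    ... | no  n+1≮v = ∸-monoˡ-≤ 1 (≮⇒≥ n+1≮v)
    ... | yes n+1<v
      with x , x∈ , x∉ ← pigeonhole {Y = P.points} Q.points!
             (subst₂ _<_ (sym P.order) (sym Q.order) (<-trans (n<1+n n) n+1<v))
      with y , y∈ , y∉ ← pigeonhole {Y = x ∷ P.points} Q.points!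
             (subst₂ _<_ (sym (cong suc P.order)) (sym Q.order) n+1<v) =
      contradiction (here (missing-unique y∈ x∈ (y∉ ∘ there) x∉)) y∉

    -- Deleting the centre of a kite leaves a single edge.
    centres⇒bound : (∀ {x} → x ∈ Q.points → ∃ λ i → Kite.labels Q.points! Q.design i 2 ≡ x) → n ≥ v
    centres⇒bound centre with n <? v
    ... | no  n≮v = ≮⇒≥ n≮v
    ... | yes n<v with x , x∈ , x∉ ← pigeonhole {Y = P.points} Q.points!
                         (subst₂ _<_ (sym P.order) (sym Q.order) n<v)
                  with i , c≡x ← centre x∈ = contradiction p≡r p≢r
      where
      open LinkedPath (linkedPath i)
      κ = Kite.labels Q.points! Q.design i
      central : ∀ {a b w} → a ∈ P.points → b ∈ P.points → a ─ b ≢ κ 2 ─ w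
      central a∈ b∈ eq with ─-injective eq
      ... | inj₁ (a≡c , _) = x∉ (subst (_∈ P.points) (trans a≡c c≡x) a∈)
      ... | inj₂ (_ , b≡c) = x∉ (subst (_∈ P.points) (trans b≡c c≡x) b∈)
      remaining : ∀ {a b} → a ∈ P.points → b ∈ P.points → Adj (K.block i) a b → a ─ b ≡ κ 0 ─ κ 1
      remaining a∈ b∈ ab with Kite.adj⇒placed Q.points! Q.design i ab
      ... | here eq                         = contradiction eq (central a∈ b∈)
      ... | there (here eq)                 = contradiction eq (central a∈ b∈)
      ... | there (there (here eq))         = contradiction eq (central a∈ b∈)
      ... | there (there (there (here eq))) = eq
      p≡r : p ≡ r
      p≡r = ─-cancelˡ (trans (─-comm q p) (trans (remaining p∈ q∈ pq) (sym (remaining q∈ r∈ qr))))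

-- For residues modulo `suc (2 * m)` this counts `m` differences up to sign, each realised by one
-- edge from every residue.
tri-odd : ∀ m → tri (suc (2 * m)) ≡ m * suc (2 * m)
tri-odd zero = refl
tri-odd (suc m) = trans (cong (tri ∘ suc) (*-suc 2 m))
  (trans (cong (λ t → 2 + 2 * m + (suc (2 * m) + t)) (tri-odd m)) (identity m))
  where
  identity : ∀ m → 2 + 2 * m + (suc (2 * m) + m * suc (2 * m)) ≡ suc m * suc (2 * suc m)
  identity = solve-∀

-- The two forms are those of `ξ i` and `ω i`, so that a small difference names its starter.
odd-or-even : ∀ d → 1 ≤ d → ∃ λ i → d ≡ suc (2 * i) ⊎ d ≡ 2 + 2 * i
odd-or-even 1 _ = 0 , inj₁ refl
odd-or-even 2 _ = 0 , inj₂ refl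
odd-or-even (suc (suc (suc d))) _ with odd-or-even (suc d) (s≤s z≤n)
... | i , inj₁ eq = suc i , inj₁ (trans (cong (2 +_) eq) (cong suc (sym (*-suc 2 i))))
... | i , inj₂ eq = suc i , inj₂ (trans (cong (2 +_) eq) (cong (2 +_) (sym (*-suc 2 i))))

-- Cyclic kite designs

-- Starter triples (2i+1, H-1-i, H+i), i ≤ j, with first two entries adding up to the third;
-- together with the even numbers below H-1-j they exhaust the differences 1, …, H+j.
module Cyclic (j H : ℕ) (j<H : j < H) (H≤ : H ≤ 3 * j + 4) where

  M : ℕ
  M = suc (2 * (H + j))

  infixl 6 _⊞_
  _⊞_ : ℕ → ℕ → ℕ
  t ⊞ s = (t + s) % M

  ⊞<M : ∀ t s → t ⊞ s < M
  ⊞<M t s = m%n<n (t + s) M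

  ⊞-assoc : ∀ t s r → t ⊞ s ⊞ r ≡ t ⊞ (s + r)
  ⊞-assoc t s r = begin
    ((t + s) % M + r) % M          ≡⟨ %-distribˡ-+ ((t + s) % M) r M ⟩
    ((t + s) % M % M + r % M) % M  ≡⟨ cong (λ q → (q + r % M) % M) (m%n%n≡m%n (t + s) M) ⟩
    ((t + s) % M + r % M) % M      ≡⟨ %-distribˡ-+ (t + s) r M ⟨
    (t + s + r) % M                ≡⟨ cong (_% M) (+-assoc t s r) ⟩
    (t + (s + r)) % M              ∎
    where open ≡-Reasoning

  ⊞-M : ∀ {t} → t < M → t ⊞ M ≡ t
  ⊞-M {t} t<M = trans ([m+n]%n≡m%n t M) (m<n⇒m%n≡m t<M)

  -- Half of the differences suffice: one above `H + j` is replaced by its complement `M ∸ e`, taken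
  -- from the larger endpoint and wrapping around to the smaller.
  differences : {S : Edge → Set} →
    (∀ d → 1 ≤ d → d ≤ H + j → ∀ {t} → t < M → S (t ─ (t ⊞ d))) →
    ∀ {a b} → a < M → b < M → a ≢ b → S (a ─ b)
  differences {S} diff {a} {b} a<M b<M a≢b =
    case-≢ (<-cmp a b)
    where
    ordered : ∀ {a b} → a < b → b < M → S (a ─ b)
    case-≢ : Tri (a < b) (a ≡ b) (b < a) → S (a ─ b)
    case-≢ (tri< a<b _ _) = ordered a<b b<M
    case-≢ (tri≈ _ a≡b _) = contradiction a≡b a≢b
    case-≢ (tri> _ _ b<a) = subst S (─-comm b a) (ordered b<a a<M)
    ordered {a} a<b b<M with m≤n⇒∃[o]m+o≡n (<⇒≤ a<b)
    ... | e , refl with e ≤? H + j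
    ...   | yes e≤ = subst (λ b → S (a ─ b)) (m<n⇒m%n≡m b<M)
      (diff e (+-cancelˡ-< a 0 e (subst (_< a + e) (sym (+-identityʳ a)) a<b)) e≤ (<-trans a<b b<M))
    ...   | no e≰ = subst S (trans (cong (a + e ─_) wraps) (─-comm (a + e) a))
      (diff (M ∸ e) (m<n⇒0<n∸m e<M)
        (≤-trans (∸-monoʳ-≤ M (≰⇒> e≰)) (≤-reflexive (trans (m+n∸m≡n (H + j) _) (+-identityʳ (H + j))))) b<M)
      where
      e<M = ≤-<-trans (m≤n+m e a) b<M
      wraps : a + e ⊞ (M ∸ e) ≡ a
      wraps = trans (cong (_% M) (trans (+-assoc a e (M ∸ e)) (cong (a +_) (m+[n∸m]≡n (<⇒≤ e<M)))))
                    (⊞-M (<-trans a<b b<M))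

  ξ ζ ω : ℕ → ℕ
  ξ i = suc (2 * i)
  ζ i = H + i
  ω i = 2 + 2 * i

  ξ-bound : ∀ {i} → i ≤ j → ξ i < M
  ξ-bound i≤j = s<s (≤-<-trans (*-monoʳ-≤ 2 i≤j) (*-monoʳ-< 2 (m<n+m j (≤-<-trans z≤n j<H))))

  -- The family `κ` is a parameter because the cyclic, the rotational and the traded design share
  -- the triangles and the count, and differ only in centres and pendant edges.
  module Blocks (κ : ℕ → ℕ → Labelling) where

    blocks : List Labelling
    blocks = concatMap (λ i → map (κ i) (upTo M)) (upTo (suc j))

    ∈-blocks⁺ : ∀ {i t} → i ≤ j → t < M → κ i t ∈ blocks
    ∈-blocks⁺ {i} i≤j t<M = concatMap-∈ (λ i → map (κ i) (upTo M)) (∈-upTo⁺ (s≤s i≤j)) (∈-map⁺ (κ i) (∈-upTo⁺ t<M))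

    ∈-blocks⁻ : ∀ {φ} → φ ∈ blocks → ∃₂ λ i t → i ≤ j × t < M × φ ≡ κ i t
    ∈-blocks⁻ φ∈ with i , i∈ , φ∈ᵢ ← find (∈-concatMap⁻ (λ i → map (κ i) (upTo M)) {xs = upTo (suc j)} φ∈)
      with t , t∈ , eq ← ∈-map⁻ (κ i) φ∈ᵢ = i , t , ≤-pred (∈-upTo⁻ i∈) , ∈-upTo⁻ t∈ , eq

    length-blocks : length (concatMap kiteEdges blocks) ≡ suc j * M * 4
    length-blocks = trans (length-concatMap kiteEdges 4 blocks λ _ → refl) (cong (_* 4)
      (trans (length-concatMap (λ i → map (κ i) (upTo M)) M (upTo (suc j))
               λ i → trans (length-map (κ i) (upTo M)) (length-upTo M))
             (cong (_* M) (length-upTo (suc j)))))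

    Covered : Edge → Set
    Covered e = e ∈ concatMap kiteEdges blocks

    covered : ∀ {i t e} → i ≤ j → t < M → e ∈ kiteEdges (κ i t) → Covered e
    covered i≤j t<M = concatMap-∈ kiteEdges (∈-blocks⁺ i≤j t<M)

    -- The edge `ξζ` has the difference H - 1 - i. Which corner is the centre is left open, as
    -- trading pendant edges will move it.
    record HasTriangle (i t : ℕ) : Set where
      constructor triangle
      field
        tξ : t ─ (t ⊞ ξ i) ∈ kiteEdges (κ i t)
        tζ : t ─ (t ⊞ ζ i) ∈ kiteEdges (κ i t)
        ξζ : (t ⊞ ξ i) ─ (t ⊞ ζ i) ∈ kiteEdges (κ i t)

    -- Differences from `H` on are `ζ i`; those below H - 1 - j are `ξ i` or `ω i` according to
    -- parity; those in between come from the third edge of a triangle.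
    residues-covered :
      (∀ {i t} → i ≤ j → t < M → HasTriangle i t) →
      (∀ {i t} → ω i + suc j < H → t < M → Covered (t ─ (t ⊞ ω i))) →
      ∀ {a b} → a < M → b < M → a ≢ b → Covered (a ─ b)
    residues-covered triangles pendants = differences {Covered} difference
      where
      open HasTriangle
      difference : ∀ d → 1 ≤ d → d ≤ H + j → ∀ {a} → a < M → Covered (a ─ (a ⊞ d))
      difference d 1≤d d≤ {a} a<M with H ≤? d
      difference d 1≤d d≤ {a} a<M | yes H≤d with m≤n⇒∃[o]m+o≡n H≤d
      ... | i , refl = covered i≤j a<M (tζ (triangles i≤j a<M))
        where i≤j = +-cancelˡ-≤ H i j d≤
      difference d 1≤d d≤ {a} a<M | no H≰d with d + suc j <? H
      ... | yes small with odd-or-even d 1≤d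
      ...   | i , inj₂ refl = pendants {i} small a<M
      ...   | i , inj₁ refl = covered i≤j a<M (tξ (triangles i≤j a<M))
        where
        -- By `H≤` a small difference is less than 2j + 3, so an odd one belongs to an available
        -- starter.
        i≤j : i ≤ j
        i≤j = ≤-pred (*-cancelˡ-< 2 i (suc j) (+-cancelʳ-≤ (suc j + 1) _ _ (begin
          suc (2 * i) + (suc j + 1)   ≡⟨ identity₁ i j ⟩
          suc (ξ i + suc j)           ≤⟨ small ⟩
          H                           ≤⟨ H≤ ⟩
          3 * j + 4                   ≡⟨ identity₂ j ⟩
          2 * suc j + (suc j + 1)     ∎)))
          where
          open ≤-Reasoning
          identity₁ : ∀ i j → suc (2 * i) + (suc j + 1) ≡ suc (suc (2 * i) + suc j)
          identity₁ = solve-∀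
          identity₂ : ∀ j → 3 * j + 4 ≡ 2 * suc j + (suc j + 1)
          identity₂ = solve-∀
      -- Here `d` is H - 1 - i. The triangle is based at `a` minus `ξ i`, so that its third edge
      -- starts at `a`.
      difference d 1≤d d≤ {a} a<M | no H≰d | no large with m≤n⇒∃[o]m+o≡n (≰⇒> H≰d)
      ... | i , H≡ = subst₂ (λ p q → Covered (p ─ q)) at-ξ at-ζ
        (covered i≤j (⊞<M a (M ∸ ξ i)) (ξζ (triangles i≤j (⊞<M a (M ∸ ξ i)))))
        where
        i≤j : i ≤ j
        i≤j = +-cancelˡ-≤ (suc d) i j (≤-trans (≤-reflexive H≡) (≤-trans (≮⇒≥ large) (≤-reflexive (+-suc d j))))
        t = a ⊞ (M ∸ ξ i)
        at-ξ : t ⊞ ξ i ≡ a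
        at-ξ = trans (⊞-assoc a (M ∸ ξ i) (ξ i))
          (trans (cong (a ⊞_) (m∸n+n≡m (<⇒≤ (ξ-bound i≤j)))) (⊞-M a<M))
        at-ζ : t ⊞ ζ i ≡ a ⊞ d
        at-ζ = begin
          t ⊞ (H + i)       ≡⟨ cong (t ⊞_) (trans (cong (_+ i) (sym H≡)) (identity d i)) ⟩
          t ⊞ (ξ i + d)     ≡⟨ ⊞-assoc t (ξ i) d ⟨
          t ⊞ ξ i ⊞ d       ≡⟨ cong (_⊞ d) at-ξ ⟩
          a ⊞ d             ∎
          where
          open ≡-Reasoning
          identity : ∀ d i → suc d + i + i ≡ suc (2 * i) + d
          identity = solve-∀

    blocks-↭ : ∀ {X} → Unique X → suc j * M * 4 ≡ tri (length X) →
      (∀ {a b} → a ∈ X → b ∈ X → a ≢ b → Covered (a ─ b)) →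
      concatMap kiteEdges blocks ↭ edges X
    blocks-↭ {X} X! size cover = covering⇒↭ (edges-unique X!) edges⊆
      (trans length-blocks (trans size (sym (length-edges X))))
      where
      edges⊆ : edges X ⊆ concatMap kiteEdges blocks
      edges⊆ e∈ with a , b , refl , a∈ , b∈ , a≢b ← ∈-edges⁻′ X! e∈ = cover a∈ b∈ a≢b

-- Cyclic designs of order 8k + 1 and rotational designs of order 8k.

module Order8k+1 (j : ℕ) where
  -- This makes `M` equal to 8(j + 1) + 1, with 4(j + 1) differences up to sign: four for each of
  -- the `suc j` starters.
  open Cyclic j (3 * j + 4)
    (≤-trans (≤-reflexive (+-comm 1 j)) (+-mono-≤ (m≤n*m j 3) (s≤s z≤n))) ≤-refl public

  size : suc j * M * 4 ≡ tri M
  size = trans (identity j M) (sym (tri-odd (3 * j + 4 + j)))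
    where
    identity : ∀ j M → suc j * M * 4 ≡ (3 * j + 4 + j) * M
    identity = solve-∀

  ω-index : ∀ {i} → ω i + suc j < 3 * j + 4 → i ≤ j
  ω-index {i} lt = *-cancelˡ-≤ 2 (+-cancelʳ-≤ (j + 4) _ _ (begin
    2 * i + (j + 4)             ≡⟨ identity₁ i j ⟩
    suc (2 + 2 * i + suc j)     ≤⟨ lt ⟩
    3 * j + 4                   ≡⟨ identity₂ j ⟩
    2 * j + (j + 4)             ∎))
    where
    open ≤-Reasoning
    identity₁ : ∀ i j → 2 * i + (j + 4) ≡ suc (2 + 2 * i + suc j)
    identity₁ = solve-∀
    identity₂ : ∀ j → 3 * j + 4 ≡ 2 * j + (j + 4)
    identity₂ = solve-∀

  κ : ℕ → ℕ → Labelling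
  κ i t = kiteOn (t ⊞ ξ i) (t ⊞ ζ i) t (t ⊞ ω i)

  open Blocks κ

  cyclic-↭ : concatMap kiteEdges blocks ↭ edges (upTo M)
  cyclic-↭ = blocks-↭ (Unique.upTo⁺ M) (trans size (cong tri (sym (length-upTo M))))
    λ a∈ b∈ → residues-covered
      (λ _ _ → triangle (here refl) (there (here refl)) (there (there (there (here refl)))))
      (λ {i} small t<M → covered (ω-index {i} small) t<M (there (there (here refl))))
      (∈-upTo⁻ a∈) (∈-upTo⁻ b∈)

  cyclic : DesignOfOrder kite M
  cyclic = kiteDesign (Unique.upTo⁺ M) (length-upTo M) cyclic-↭ (∈-blocks⁺ {0} {0} z≤n (s≤s z≤n))

  -- The translate of the first starter by `c` is centred at `c`. The labels recovered from a design
  -- made by `toDesign` are definitionally the listed ones, so its position in the list gives the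
  -- block.
  cyclic-centres : ∀ {c} → c ∈ upTo M →
    ∃ λ i → Kite.labels (Unique.upTo⁺ M) (DesignOfOrder.design cyclic) i 2 ≡ c
  cyclic-centres {c} c∈ = Any.index φ∈ , cong (_$ 2) (sym (lookup-index φ∈))
    where φ∈ = ∈-blocks⁺ {0} {c} z≤n (∈-upTo⁻ c∈)

module Order8k (j : ℕ) where
  -- Now `M` is 8j + 7, with 4j + 3 differences up to sign. The starters have one edge more, which
  -- goes to the fixed point.
  open Cyclic j (3 * j + 3)
    (≤-trans (≤-reflexive (+-comm 1 j)) (+-mono-≤ (m≤n*m j 3) (s≤s z≤n))) (+-monoʳ-≤ (3 * j) (n≤1+n 3)) public

  size : suc j * M * 4 ≡ tri (suc M)
  size = trans (identity j M) (cong (M +_) (sym (tri-odd (3 * j + 3 + j))))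
    where
    identity : ∀ j M → suc j * M * 4 ≡ M + (3 * j + 3 + j) * M
    identity = solve-∀

  -- The strict inequality keeps the pendant edge of the last starter free for the fixed point.
  ω-index : ∀ {i} → ω i + suc j < 3 * j + 3 → i < j
  ω-index {i} lt = *-cancelˡ-< 2 i j (+-cancelʳ-≤ (j + 3) _ _ (begin
    suc (2 * i) + (j + 3)       ≡⟨ identity₁ i j ⟩
    suc (2 + 2 * i + suc j)     ≤⟨ lt ⟩
    3 * j + 3                   ≡⟨ identity₂ j ⟩
    2 * j + (j + 3)             ∎))
    where
    open ≤-Reasoning
    identity₁ : ∀ i j → suc (2 * i) + (j + 3) ≡ suc (2 + 2 * i + suc j)
    identity₁ = solve-∀
    identity₂ : ∀ j → 3 * j + 3 ≡ 2 * j + (j + 3)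
    identity₂ = solve-∀

  -- The point M is fixed by the rotation; it is the pendant vertex of the last starter.
  tip : ℕ → ℕ → ℕ
  tip i t = if does (i <? j) then t ⊞ ω i else M

  tip-< : ∀ {i} t → i < j → tip i t ≡ t ⊞ ω i
  tip-< {i} t i<j rewrite dec-true (i <? j) i<j = refl

  tip-j : ∀ t → tip j t ≡ M
  tip-j t rewrite dec-false (j <? j) (<-irrefl refl) = refl

  κ : ℕ → ℕ → Labelling
  κ i t = kiteOn (t ⊞ ξ i) (t ⊞ ζ i) t (tip i t)

  open Blocks κ

  rotational-covered : ∀ {a b} → a < M → b < M → a ≢ b → Covered (a ─ b)
  rotational-covered = residues-covered
    (λ _ _ → triangle (here refl) (there (here refl)) (there (there (there (here refl)))))
    (λ {i} {t} small t<M → let i<j = ω-index {i} small in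
      covered (<⇒≤ i<j) t<M (there (there (here (cong (t ─_) (sym (tip-< t i<j)))))))

  fixed-covered : ∀ {a} → a < M → Covered (a ─ M)
  fixed-covered {a} a<M = covered ≤-refl a<M (there (there (here (cong (a ─_) (sym (tip-j a))))))

  all-covered : ∀ {a b} → a < suc M → b < suc M → a ≢ b → Covered (a ─ b)
  all-covered {a} {b} a≤M b≤M a≢b with m≤n⇒m<n∨m≡n (≤-pred a≤M) | m≤n⇒m<n∨m≡n (≤-pred b≤M)
  ... | inj₁ a<M  | inj₁ b<M  = rotational-covered a<M b<M a≢b
  ... | inj₁ a<M  | inj₂ refl = fixed-covered a<M
  ... | inj₂ refl | inj₁ b<M  = subst Covered (─-comm b M) (fixed-covered b<M)
  ... | inj₂ refl | inj₂ refl = contradiction refl a≢b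

  rotational : DesignOfOrder kite (suc M)
  rotational = kiteDesign (Unique.upTo⁺ (suc M)) (length-upTo (suc M))
    (blocks-↭ (Unique.upTo⁺ (suc M)) (trans size (cong tri (sym (length-upTo (suc M)))))
      λ a∈ b∈ → all-covered (∈-upTo⁻ a∈) (∈-upTo⁻ b∈))
    (∈-blocks⁺ {0} {0} z≤n (s≤s z≤n))

-- Deleting a point that is never a centre.

-- Meaningful only when o is not the centre φ 2.
avoiding : ℕ → Labelling → Labelling
avoiding o φ with φ 0 ≟ o | φ 1 ≟ o
... | yes _ | _     = path (φ 1) (φ 2) (φ 3)
... | no _  | yes _ = path (φ 0) (φ 2) (φ 3)
-- This includes the case that `φ 3` is `o`, since the path omits `φ 3`.
... | no _  | no _  = path (φ 0) (φ 1) (φ 2)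

leftover : ℕ → Labelling → List Edge
leftover o φ with φ 0 ≟ o | φ 1 ≟ o
... | yes _ | _     = (φ 2 ─ φ 0) ∷ (φ 0 ─ φ 1) ∷ []
... | no _  | yes _ = (φ 2 ─ φ 1) ∷ (φ 0 ─ φ 1) ∷ []
... | no _  | no _  = (φ 2 ─ φ 0) ∷ (φ 2 ─ φ 3) ∷ []

avoiding-↭ : ∀ o φ → kiteEdges φ ↭ pathEdges (avoiding o φ) ++ leftover o φ
avoiding-↭ o φ with φ 0 ≟ o | φ 1 ≟ o
... | yes _ | _ rewrite ─-comm (φ 1) (φ 2) =
  solve 4 (λ ca cb cd ab → ca ⊕ cb ⊕ cd ⊕ ab ⊜ cb ⊕ cd ⊕ ca ⊕ ab) ↭-refl
    [ φ 2 ─ φ 0 ] [ φ 2 ─ φ 1 ] [ φ 2 ─ φ 3 ] [ φ 0 ─ φ 1 ]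
... | no _ | yes _ rewrite ─-comm (φ 0) (φ 2) =
  solve 4 (λ ca cb cd ab → ca ⊕ cb ⊕ cd ⊕ ab ⊜ ca ⊕ cd ⊕ cb ⊕ ab) ↭-refl
    [ φ 2 ─ φ 0 ] [ φ 2 ─ φ 1 ] [ φ 2 ─ φ 3 ] [ φ 0 ─ φ 1 ]
... | no _ | no _ rewrite ─-comm (φ 1) (φ 2) =
  solve 4 (λ ca cb cd ab → ca ⊕ cb ⊕ cd ⊕ ab ⊜ ab ⊕ cb ⊕ ca ⊕ cd) ↭-refl
    [ φ 2 ─ φ 0 ] [ φ 2 ─ φ 1 ] [ φ 2 ─ φ 3 ] [ φ 0 ─ φ 1 ]

avoiding-≢ : ∀ {o φ} → Unique (map φ (0 ∷ 1 ∷ 2 ∷ 3 ∷ [])) → φ 2 ≢ o →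
  avoiding o φ 0 ≢ o × avoiding o φ 1 ≢ o × avoiding o φ 2 ≢ o
avoiding-≢ {o} {φ} ((a≢b ∷ _ ∷ a≢d ∷ []) ∷ (_ ∷ b≢d ∷ []) ∷ _) c≢o with φ 0 ≟ o | φ 1 ≟ o
... | yes refl | _        = a≢b ∘ sym , c≢o , a≢d ∘ sym
... | no a≢o   | yes refl = a≢o , c≢o , b≢d ∘ sym
... | no a≢o   | no b≢o   = a≢o , b≢o , c≢o

avoiding-path : ∀ {o Φ} (Y! : Unique Y) (𝓑 : Design (complete Y Y!) kite) (i : Fin (Design.size 𝓑)) →
  Kite.labels Y! 𝓑 i ≡ Φ → HasPath (Design.block 𝓑 i) (avoiding o Φ)
avoiding-path {o = o} Y! 𝓑 i refl = adj (here refl) , adj (there (here refl))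
  where
  κ = Kite.labels Y! 𝓑 i
  adj : ∀ {a b} → a ─ b ∈ pathEdges (avoiding o κ) → Adj (Design.block 𝓑 i) a b
  adj e∈ = Kite.placed⇒adj Y! 𝓑 i (∈-resp-↭ (↭-sym (avoiding-↭ o κ)) (∈-++⁺ˡ e∈))

-- As `o` is never a centre, every kite retains a path away from `o`. A tree on `Y` made of leftover
-- edges avoids both `o` and these paths, so `completion` applies.
punctured : ∀ {o Φ} → Unique (o ∷ Y) → concatMap kiteEdges Φ ↭ edges (o ∷ Y) →
  (∀ {φ} → φ ∈ Φ → φ 2 ≢ o) → 2 ∣ tri (length Y) →
  (T : Tree Y) → treeEdges T ⊆ concatMap (leftover o) Φ →
  ∃ λ Ψ → concatMap pathEdges (map (avoiding o) Φ ++ Ψ) ↭ edges Y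
punctured {Y} {o} {Φ} X!@(_ ∷ Y!) Φ↭ centre≢o even T T⊆ =
  completion {Φ = map (avoiding o) Φ} Y! even T (proj₂ remainder) tree⊆
  where
  C = concatMap pathEdges (map (avoiding o) Φ)
  X↭ : edges (o ∷ Y) ↭ C ++ concatMap (leftover o) Φ
  X↭ = ↭-trans (↭-sym Φ↭) (↭-trans
    (concatMap-split kiteEdges (pathEdges ∘ avoiding o) (leftover o) Φ (λ {φ} _ → avoiding-↭ o φ))
    (↭-reflexive (cong (_++ concatMap (leftover o) Φ) (sym (concatMap-map pathEdges (avoiding o) Φ)))))
  packed! : Unique (C ++ concatMap (leftover o) Φ)
  packed! = unique-↭ X↭ (edges-unique X!)
  drop-o : ∀ {a b} → a ≢ o → b ≢ o → a ─ b ∈ edges (o ∷ Y) → a ─ b ∈ edges Y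
  drop-o a≢o b≢o e∈ with a∈ , b∈ , a≢b ← ∈-edges⁻ X! e∈ =
    ∈-edges⁺ (Any.tail a≢o a∈) (Any.tail b≢o b∈) a≢b
  C⊆X : ∀ {φ e} → φ ∈ Φ → e ∈ pathEdges (avoiding o φ) → e ∈ edges (o ∷ Y)
  C⊆X φ∈ e∈ = ∈-resp-↭ (↭-sym X↭) (∈-++⁺ˡ (concatMap-∈ pathEdges (∈-map⁺ (avoiding o) φ∈) e∈))
  C⊆ : C ⊆ edges Y
  C⊆ e∈ with _ , ψ∈ , e∈ψ ← find (∈-concatMap⁻ pathEdges {xs = map (avoiding o) Φ} e∈)
    with φ , φ∈ , refl ← ∈-map⁻ (avoiding o) ψ∈
    with p≢ , q≢ , r≢ ← avoiding-≢ {o} {φ} (kite-vertices-unique X! Φ↭ φ∈) (centre≢o φ∈) | e∈ψ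
  ... | here refl         = drop-o p≢ q≢ (C⊆X φ∈ (here refl))
  ... | there (here refl) = drop-o q≢ r≢ (C⊆X φ∈ (there (here refl)))
  remainder : ∃ λ R → edges Y ↭ C ++ R
  remainder = unique-⊆⇒↭ (++-uniqueˡ C packed!) C⊆
  tree⊆ : treeEdges T ⊆ proj₁ remainder
  tree⊆ e∈ with a , b , refl , a∈ , b∈ ← parents-∈ T e∈
    with _ , _ , a≢b ← ∈-edges⁻ X! (∈-resp-↭ (↭-sym X↭) (∈-++⁺ʳ C (T⊆ e∈)))
    with ∈-++⁻ C (∈-resp-↭ (proj₂ remainder) (∈-edges⁺ a∈ b∈ a≢b))
  ... | inj₁ e∈C = contradiction (e∈C , T⊆ e∈) (++-unique⇒disjoint C packed!)
  ... | inj₂ e∈R = e∈R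

leftover-regular : ∀ {o φ} → φ 0 ≢ o → φ 1 ≢ o → leftover o φ ≡ (φ 2 ─ φ 0) ∷ (φ 2 ─ φ 3) ∷ []
leftover-regular {o} {φ} a≢o b≢o with φ 0 ≟ o | φ 1 ≟ o
... | yes a≡o | _       = contradiction a≡o a≢o
... | no _    | yes b≡o = contradiction b≡o b≢o
... | no _    | no _    = refl

-- The cyclic design with, for each i, the edges {0, ω i} and {ξ i, ξ i + 2} exchanged
-- between the kites (i, 0) and (0, ξ i), which makes 0 a non-central vertex everywhere.
module Traded (j : ℕ) where
  open Order8k+1 j using (M; _⊞_; ξ; ζ; ω; size; ω-index; ξ-bound; module Blocks)

  N : ℕ
  N = 2 * (3 * j + 4 + j)

  odds : List ℕ
  odds = map ξ (upTo (suc j))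

  standard : ℕ → ℕ → Labelling
  standard i t = kiteOn (t ⊞ ξ i) (t ⊞ ζ i) t (t ⊞ ω i)

  swapped : ℕ → ℕ → ℕ → Labelling
  swapped i t d = kiteOn t (t ⊞ ζ i) (t ⊞ ξ i) d

  -- Kite (i, 0) is recentred at `ξ i` with pendant vertex ξ i + 2, and kite (0, ξ i) at ξ i + 1,
  -- which is `ω i`, with pendant vertex 0. All triangles stay as they were.
  κ : ℕ → ℕ → Labelling
  κ i       zero      = swapped i 0 (0 ⊞ suc (ω i))
  κ (suc i) t@(suc _) = standard (suc i) t
  κ zero    t@(suc _) = if does (t ∈? odds) then swapped 0 t 0 else standard 0 t

  κ-odd : ∀ {t} → suc t ∈ odds → κ 0 (suc t) ≡ swapped 0 (suc t) 0
  κ-odd {t} t∈ rewrite dec-true (suc t ∈? odds) t∈ = refl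

  κ-standard : ∀ {t} → suc t ∉ odds → κ 0 (suc t) ≡ standard 0 (suc t)
  κ-standard {t} t∉ rewrite dec-false (suc t ∈? odds) t∉ = refl

  open Blocks κ

  from-standard : ∀ {i t} → κ i t ≡ standard i t → HasTriangle i t
  from-standard eq = triangle (on (here refl)) (on (there (here refl))) (on (there (there (there (here refl)))))
    where on = λ {e} → subst (λ φ → e ∈ kiteEdges φ) (sym eq)

  from-swapped : ∀ {i t d} → κ i t ≡ swapped i t d → HasTriangle i t
  from-swapped {i} {t} eq =
    triangle (on (here (─-comm t (t ⊞ ξ i)))) (on (there (there (there (here refl))))) (on (there (here refl)))
    where on = λ {e} → subst (λ φ → e ∈ kiteEdges φ) (sym eq)

  triangles : ∀ {i t} → HasTriangle i t
  triangles {i} {zero} = from-swapped refl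
  triangles {suc i} {suc t} = from-standard refl
  triangles {zero} {suc t} with suc t ∈? odds
  ... | yes t∈ = from-swapped (κ-odd t∈)
  ... | no  t∉ = from-standard (κ-standard t∉)

  ∈-odds : ∀ {i} → i ≤ j → ξ i ∈ odds
  ∈-odds i≤j = ∈-map⁺ ξ (∈-upTo⁺ (s≤s i≤j))

  ω-bound : ∀ {i} → i ≤ j → ω i < M
  ω-bound {i} i≤j = s≤s (≤-trans (≤-reflexive (sym (*-suc 2 i)))
    (*-monoʳ-≤ 2 (≤-trans (s≤s i≤j) (+-monoˡ-≤ j (≤-trans (s≤s z≤n) (m≤n+m 4 (3 * j)))))))

  ∈-odds⁻ : ∀ {t} → t ∈ odds → ∃ λ m → m ≤ j × t ≡ ξ m
  ∈-odds⁻ t∈ with m , m∈ , eq ← ∈-map⁻ ξ {xs = upTo (suc j)} t∈ = m , ≤-pred (∈-upTo⁻ m∈) , eq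

  0⊞ξ : ∀ {i} → i ≤ j → 0 ⊞ ξ i ≡ ξ i
  0⊞ξ i≤j = m<n⇒m%n≡m (ξ-bound i≤j)

  third : ∀ {i t e φ} → i ≤ j → t < M → κ i t ≡ φ → e ≡ φ 2 ─ φ 3 → Covered e
  third i≤j t<M eq refl = covered i≤j t<M (there (there (here (cong (λ φ → φ 2 ─ φ 3) (sym eq)))))

  pendants : ∀ {i t} → i ≤ j → t < M → Covered (t ─ (t ⊞ ω i))
  -- The edge from 0 to `ω i` has moved to the kite `κ 0 (ξ i)`.
  pendants {i} {zero} i≤j _ = third {0} {ξ i} z≤n (ξ-bound i≤j) (κ-odd (∈-odds i≤j))
    (trans (─-comm 0 (0 ⊞ ω i)) (cong (λ s → s % M ─ 0) (+-comm 1 (ξ i))))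
  pendants {suc i} {suc t} i≤j t<M = third {suc i} i≤j t<M refl refl
  pendants {zero} {suc t} _ t<M with suc t ∈? odds
  ... | no  t∉ = third z≤n t<M (κ-standard t∉) refl
  -- Conversely the edge from `ξ m` to ξ m + 2 has moved to the kite `κ m 0`.
  ... | yes t∈ with m , m≤j , refl ← ∈-odds⁻ t∈ =
    third {m} m≤j (s≤s z≤n) refl
      (cong₂ _─_ (sym (0⊞ξ m≤j)) (cong (_% M) (+-comm (ξ m) 2)))

  -- Descending order lets a tree rooted at 1 grow by prepending the next number.
  Z : List ℕ
  Z = applyDownFrom suc N

  X! : Unique (0 ∷ Z)
  X! = All.tabulate 0∉ ∷
    Unique.applyDownFrom⁺₁ suc N λ k<i _ eq → <⇒≢ k<i (sym (suc-injective eq))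
    where
    0∉ : ∀ {y} → y ∈ Z → 0 ≢ y
    0∉ y∈ with _ , _ , refl ← ∈-applyDownFrom⁻ suc y∈ = λ ()

  <M : ∀ {a} → a ∈ 0 ∷ Z → a < M
  <M (here refl) = s≤s z≤n
  <M (there a∈) with _ , k<N , refl ← ∈-applyDownFrom⁻ suc a∈ = s≤s k<N

  order : length (0 ∷ Z) ≡ M
  order = cong suc (length-applyDownFrom suc N)

  traded-↭ : concatMap kiteEdges blocks ↭ edges (0 ∷ Z)
  traded-↭ = blocks-↭ X! (trans size (cong tri (sym order)))
    λ a∈ b∈ → residues-covered (λ _ _ → triangles) (λ {i} small → pendants (ω-index {i} small)) (<M a∈) (<M b∈)

  traded : DesignOfOrder kite M
  traded = kiteDesign X! order traded-↭ (∈-blocks⁺ {0} {0} z≤n (s≤s z≤n))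

  -- The centre is `ξ i` for t = 0, `ω m` for the recentred kite at t = ξ m, and otherwise the
  -- nonzero `t`; none of these wraps around to 0.
  centre≢0 : ∀ {φ} → φ ∈ blocks → φ 2 ≢ 0
  centre≢0 φ∈ with i , t , i≤j , t<M , φ≡ ← ∈-blocks⁻ φ∈ = subst (λ φ → φ 2 ≢ 0) (sym φ≡) (κ-centre i t i≤j t<M)
    where
    odd-centre : ∀ {t} → suc t ∈ odds → suc t ⊞ ξ 0 ≢ 0
    odd-centre t∈ eq with m , m≤j , refl ← ∈-odds⁻ t∈ =
      1+n≢0 (trans (sym (m<n⇒m%n≡m (subst (_< M) (+-comm 1 (ξ m)) (ω-bound m≤j)))) eq)
    κ-centre : ∀ i t → i ≤ j → t < M → κ i t 2 ≢ 0
    κ-centre i       zero    i≤j _ eq = 1+n≢0 (trans (sym (0⊞ξ i≤j)) eq)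
    κ-centre (suc i) (suc t) _   _ ()
    κ-centre zero    (suc t) _   _ with suc t ∈? odds
    ... | no  t∉ = subst (λ φ → φ 2 ≢ 0) (sym (κ-standard t∉)) λ ()
    ... | yes t∈ = subst (λ φ → φ 2 ≢ 0) (sym (κ-odd t∈)) (odd-centre t∈)

  wraps-to-0 : ∀ {a} → 0 < a → a < M + M → a % M ≡ 0 → a ≡ M
  wraps-to-0 {a} 0<a a<2M a%M≡0 with a <? M
  ... | yes a<M = contradiction (trans (sym (m<n⇒m%n≡m a<M)) a%M≡0) (m<n⇒n≢0 0<a)
  ... | no a≮M with m≤n⇒∃[o]m+o≡n (≮⇒≥ a≮M)
  ...   | zero , eq = trans (sym eq) (+-identityʳ M)
  ...   | suc o , refl = contradiction
    (trans (sym (trans (cong (_% M) (+-comm M (suc o)))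
                       (trans ([m+n]%n≡m%n (suc o) M) (m<n⇒m%n≡m (+-cancelˡ-< M _ _ a<2M))))) a%M≡0)
    λ ()

  -- With `ζ 0` equal to 3j + 4 and `M` to 8j + 9, the sum wraps to 0 exactly at t = 5j + 5.
  apex≢0 : ∀ {t} → t < M → t ≢ 5 + 5 * j → t ⊞ ζ 0 ≢ 0
  apex≢0 {t} t<M t≢ eq =
    t≢ (+-cancelʳ-≡ (ζ 0) t (5 + 5 * j) (trans (wraps-to-0 positive (+-mono-< t<M ζ<M) eq) (identity j)))
    where
    positive : 0 < t + ζ 0
    positive = ≤-trans (≤-trans (s≤s z≤n) (m≤n+m 4 (3 * j))) (≤-trans (m≤m+n (3 * j + 4) 0) (m≤n+m (ζ 0) t))
    ζ<M : ζ 0 < M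
    ζ<M = s≤s (≤-trans (+-monoʳ-≤ (3 * j + 4) z≤n) (m≤m+n (3 * j + 4 + j) _))
    identity : ∀ j → suc (2 * (3 * j + 4 + j)) ≡ 5 + 5 * j + (3 * j + 4 + 0)
    identity = solve-∀

  Left : Edge → Set
  Left e = e ∈ concatMap (leftover 0) blocks

  left : ∀ {t e φ} → t < M → κ 0 t ≡ φ → φ 0 ≢ 0 → φ 1 ≢ 0 → e ∈ (φ 2 ─ φ 0) ∷ (φ 2 ─ φ 3) ∷ [] → Left e
  left {t} t<M refl a≢0 b≢0 e∈ = concatMap-∈ (leftover 0) (∈-blocks⁺ {0} {t} z≤n t<M)
    (subst (_ ∈_) (sym (leftover-regular {0} {κ 0 t} a≢0 b≢0)) e∈)

  next : ∀ {t} → t < N → t ⊞ ξ 0 ≡ suc t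
  next {t} t<N = trans (cong (_% M) (+-comm t 1)) (m<n⇒m%n≡m (s≤s t<N))

  next≢0 : ∀ {t} → t < N → t ⊞ ξ 0 ≢ 0
  next≢0 t<N eq = 1+n≢0 (trans (sym (next t<N)) eq)

  -- Standard or swapped, the kite (0, t) has its edge of difference 1 between `φ 2` and `φ 0`. It
  -- is left over unless `φ 1` is 0, when the path avoiding 0 uses it.
  step-left : ∀ {t} → suc t < N → suc t ≢ 5 + 5 * j → Left (suc t ─ (2 + t))
  step-left {t} t<N t≢ with suc t ∈? odds
  ... | yes t∈ = left (m≤n⇒m≤1+n t<N) (κ-odd t∈) (λ ()) (apex≢0 (m≤n⇒m≤1+n t<N) t≢)
    (here (trans (─-comm (suc t) (2 + t)) (cong (_─ suc t) (sym (next t<N)))))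
  ... | no  t∉ = left (m≤n⇒m≤1+n t<N) (κ-standard t∉) (next≢0 t<N) (apex≢0 (m≤n⇒m≤1+n t<N) t≢)
    (here (cong (suc t ─_) (sym (next t<N))))

  -- Replaces the one missing step: the pendant edge of the kite (0, 5j + 4) has difference 2. That
  -- kite is not swapped, as 5j + 4 exceeds 2j + 1, the largest entry of `odds`.
  skip-left : 6 + 5 * j < M → Left ((4 + 5 * j) ─ (6 + 5 * j))
  skip-left <M = left t<M (κ-standard t∉) (next≢0 (≤-trans (n≤1+n _) (≤-pred <M)))
    (apex≢0 t<M λ eq → 1+n≢n (sym eq))
    (there (here (cong (4 + 5 * j ─_) (sym (trans (cong (_% M) (+-comm (4 + 5 * j) 2)) (m<n⇒m%n≡m <M))))))
    where
    t<M : 4 + 5 * j < M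
    t<M = ≤-trans (m≤n+m _ 2) <M
    t∉ : 4 + 5 * j ∉ odds
    t∉ t∈ with m , m≤j , eq ← ∈-odds⁻ t∈ = contradiction (sym eq) (<⇒≢ (s≤s (≤-trans (s≤s (≤-trans
      (*-monoʳ-≤ 2 m≤j) (*-monoˡ-≤ j {2} {5} (s≤s (s≤s z≤n))))) (m≤n+m (suc (5 * j)) 2))))

  -- The path 1, 2, …, n, except that 6 + 5j hangs from 4 + 5j instead of from 5 + 5j.
  spanning : ∀ n → 0 < n → n ≤ N → ∃ λ (T : Tree (applyDownFrom suc n)) → ∀ {e} → e ∈ treeEdges T → Left e
  spanning 1 _ _ = root 1 , λ ()
  spanning 2 _ 2≤N = leaf 2 (here refl) (root 1) , λ { (here refl) → step-left 2≤N λ () }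
  spanning (suc (suc (suc m))) _ n≤N
    -- The new leaf is 3 + m, so the test asks whether it is 5j + 6; its substitute parent 1 + m is
    -- then second in the list.
    with T , T-left ← spanning (suc (suc m)) (s≤s z≤n) (<⇒≤ n≤N) | suc m ≟ 4 + 5 * j
  ... | yes refl = leaf (6 + 5 * j) {4 + 5 * j} (there (here refl)) T ,
    λ { (here refl) → skip-left (s≤s n≤N) ; (there e∈) → T-left e∈ }
  ... | no  m≢   = leaf (3 + m) {2 + m} (here refl) T ,
    λ { (here refl) → step-left n≤N (m≢ ∘ suc-injective) ; (there e∈) → T-left e∈ }

  0<N : 0 < N
  0<N = ≤-trans (s≤s z≤n) (≤-trans (m≤n+m 4 (3 * j)) (≤-trans (m≤m+n (3 * j + 4) j) (m≤m+n (3 * j + 4 + j) _)))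

  decomposition : 2 ∣ tri N → ∃ λ Ψ → concatMap pathEdges (map (avoiding 0) blocks ++ Ψ) ↭ edges Z
  decomposition even = punctured X! traded-↭ centre≢0
    (subst (λ n → 2 ∣ tri n) (sym (length-applyDownFrom suc N)) even)
    (proj₁ (spanning N 0<N ≤-refl)) (proj₂ (spanning N 0<N ≤-refl))

  traded-downLink : 2 ∣ tri N → DownLinkable traded N
  traded-downLink even = downLinkable traded (++-uniqueʳ [ 0 ] X!) (length-applyDownFrom suc N)
    (proj₂ (decomposition even)) (∈-++⁺ˡ (∈-map⁺ (avoiding 0) (∈-blocks⁺ {0} {0} z≤n (s≤s z≤n))))
    λ i → avoiding 0 (lookup blocks i) , ∈-++⁺ˡ (∈-map⁺ (avoiding 0) (∈-lookup {xs = blocks} i)) ,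
          avoiding-path X! (DesignOfOrder.design traded) i refl

-- The spectra for each order.

Admissible : ℕ → Set
Admissible n = n % 4 ≡ 0 ⊎ n % 4 ≡ 1

Characterised : ℕ → Set₁
Characterised v = 𝓛₁ kite v ≐ (λ n → n ≥ v ∸ 1 × Admissible n) × 𝓛₂ kite v ≐ (λ n → n ≥ v × Admissible n)

-- Orders from `v` on are reached from every design. What depends on the residue of `v` is whether v
-- - 1 is attained at all, and why not every design attains it.
characterise : ∀ {v} → v > 1 → DesignOfOrder kite v →
  (Admissible (v ∸ 1) → 𝓛₁ kite v (v ∸ 1)) →
  (∀ {n} → Admissible n → 𝓛₂ kite v n → n ≥ v) →
  Characterised v
characterise {v} v>1 𝓑 below bound = (sound₁ , complete₁) , (sound₂ , complete₂)
  where
  sound₁ : ∀ {n} → 𝓛₁ kite v n → n ≥ v ∸ 1 × Admissible n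
  sound₁ (𝓑 , 𝓑′ , link) = order-bound 𝓑′ 𝓑 link , P₃-order 𝓑′
  complete₁ : ∀ {n} → n ≥ v ∸ 1 × Admissible n → 𝓛₁ kite v n
  complete₁ {n} (n≥ , r) with m≤n⇒m<n∨m≡n n≥
  ... | inj₁ v-1<n = 𝓑 , kite-downLink 𝓑 v>1 (≤-trans (m≤n+m∸n v 1) v-1<n) r
  ... | inj₂ refl  = below r
  sound₂ : ∀ {n} → 𝓛₂ kite v n → n ≥ v × Admissible n
  sound₂ link = bound (P₃-order (proj₁ (link 𝓑))) link , P₃-order (proj₁ (link 𝓑))
  complete₂ : ∀ {n} → n ≥ v × Admissible n → 𝓛₂ kite v n
  complete₂ (n≥v , r) 𝓑 = kite-downLink 𝓑 v>1 n≥v r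

-- Two designs of the same order serve opposite ends: `traded` reaches order v - 1, whereas in
-- `cyclic` every point is a centre.
order8k+1 : ∀ j → Characterised (Order8k+1.M j)
order8k+1 j = characterise (s≤s (Traded.0<N j)) cyclic
  (λ r → Traded.traded j , Traded.traded-downLink j (tri-even⇐ (Traded.N j) r))
  (λ _ link → centres⇒bound (proj₁ (link cyclic)) cyclic (proj₂ (link cyclic)) cyclic-centres)
  where open Order8k+1 j

-- Here v - 1 is 3 modulo 4, so the general bound v - 1 sharpens to `v` without regard to centres.
order8k : ∀ j → Characterised (suc (Order8k.M j))
order8k j = characterise (s≤s (s≤s z≤n)) rotational
  (λ r → contradiction r inadmissible)
  (λ {n} r link → bound r (order-bound (proj₁ (link rotational)) rotational (proj₂ (link rotational))))
  where
  open Order8k j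
  M%4≡3 : M % 4 ≡ 3
  M%4≡3 = trans (cong (_% 4) (identity j)) ([m+kn]%n≡m%n 3 (2 * j + 1) 4)
    where
    identity : ∀ j → suc (2 * (3 * j + 3 + j)) ≡ 3 + (2 * j + 1) * 4
    identity = solve-∀
  inadmissible : ¬ Admissible M
  inadmissible (inj₁ eq) = contradiction (trans (sym M%4≡3) eq) λ ()
  inadmissible (inj₂ eq) = contradiction (trans (sym M%4≡3) eq) λ ()
  bound : ∀ {n} → Admissible n → n ≥ M → n ≥ suc M
  bound r n≥M with m≤n⇒m<n∨m≡n n≥M
  ... | inj₁ M<n  = M<n
  ... | inj₂ refl = contradiction r inadmissible

order-cases : ∀ v → v % 8 ≡ 0 ⊎ v % 8 ≡ 1 → v > 1 →
              ∃ λ j → v ≡ suc (Order8k.M j) ⊎ v ≡ Order8k+1.M j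
order-cases v r v>1 with v / 8 | m≡m%n+[m/n]*n v 8 | r
-- Quotient 0 would make `v` equal to 0 or 1; hence k is at least 1 and `j` is k - 1.
... | zero  | eq | inj₁ r≡ = contradiction (trans eq (cong (_+ 0) r≡)) (>⇒≢ (≤-trans (s≤s z≤n) v>1))
... | zero  | eq | inj₂ r≡ = contradiction (trans eq (cong (_+ 0) r≡)) (>⇒≢ v>1)
... | suc j | eq | inj₁ r≡ = j , inj₁ (trans eq (trans (cong (_+ suc j * 8) r≡) (identity j)))
  where
  identity : ∀ j → suc j * 8 ≡ suc (suc (2 * (3 * j + 3 + j)))
  identity = solve-∀
... | suc j | eq | inj₂ r≡ = j , inj₂ (trans eq (trans (cong (_+ suc j * 8) r≡) (identity j)))
  where
  identity : ∀ j → 1 + suc j * 8 ≡ suc (2 * (3 * j + 4 + j))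
  identity = solve-∀

theorem6p4 : (v : ℕ) → v % 8 ≡ 0 ⊎ v % 8 ≡ 1 → v > 1 →
    𝓛₁ kite v ≐ (λ n → n ≥ v ∸ 1 × (n % 4 ≡ 0 ⊎ n % 4 ≡ 1))
    ×
    𝓛₂ kite v ≐ (λ n → n ≥ v × (n % 4 ≡ 0 ⊎ n % 4 ≡ 1))
theorem6p4 v r v>1 with order-cases v r v>1
... | j , inj₁ refl = order8k j
... | j , inj₂ refl = order8k+1 j
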